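{- Let $N$ be a finite set with $|N|\geq 2$ and let $m\in\mathbb{R}^{\mathcal{P}(N)}$ with $m(\emptyset)=0$. Then the following conditions are equivalent: (i) $m$ is an exact game over $N$, that is, $m\in\mathcal{E}(N)$; (ii) for every semi-balanced set system $\mathcal{S}$ on $N$ one has $\langle\theta,m\rangle\geq 0$ for all $\theta\in\Theta_{\mathcal{S}}$; (iii) for every min-semi-balanced set system $\mathcal{S}$ on $N$ one has $\langle\theta_{\mathcal{S}},m\rangle\geq 0$.
   Context: $\mathcal{P}(N)$ is the power set of $N$, $\subset$ is strict inclusion, and $\chi_S\in\mathbb{R}^N$ is the incidence vector of $S\subseteq N$. A constant vector in $\mathbb{R}^N$ is a vector $[r,\ldots,r]$, $r\in\mathbb{R}$. A linear combination is affine if its coefficients sum to $1$, and semi-conic if at most one of its coefficients is strictly negative. Write $\langle\theta,m\rangle=\sum_{S\subseteq N}\theta(S)m(S)$. A non-trivial set system on $N$ is a system $\mathcal{S}$ with $\emptyset\neq\mathcal{S}\subseteq\mathcal{P}(N)\setminus\{\emptyset,N\}$. It is semi-balanced (on $N$) if some constant vector in $\mathbb{R}^N$ is a semi-conic combination of $\{\chi_S:S\in\mathcal{S}\}$ with all coefficients non-zero. It is min-semi-balanced if it is semi-balanced and no semi-balanced $\mathcal{C}\subset\mathcal{S}$ exists. For a non-trivial set system $\mathcal{S}$ on $N$, any affine semi-conic combination $\sum_{S\in\mathcal{S}}\lambda_S\chi_S$ (zero coefficients allowed) yielding a constant vector $[r,\ldots,r]$ is assigned the vector $\theta\in\mathbb{R}^{\mathcal{P}(N)}$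 with $\theta(S)=-\lambda_S$ for $S\in\mathcal{S}$, $\theta(N)=r$, $\theta(\emptyset)=1-r$, and $\theta(L)=0$ for other $L\subseteq N$. $\Theta_{\mathcal{S}}$ is the set of vectors $\theta$ for all such combinations. If $|\Theta_{\mathcal{S}}|=1$ (which holds whenever $\mathcal{S}$ is min-semi-balanced), its only element is denoted $\theta_{\mathcal{S}}$. A game over $N$ is $m\in\mathbb{R}^{\mathcal{P}(N)}$ with $m(\emptyset)=0$. Its core is $C(m)=\{x\in\mathbb{R}^N:\sum_{i\in N}x_i=m(N),\ \sum_{i\in S}x_i\geq m(S)\ \forall S\subseteq N\}$. The game $m$ is exact if for each $S\subseteq N$ there is $x\in C(m)$ with $\sum_{i\in S}x_i=m(S)$. $\mathcal{E}(N)$ is the set of exact games over $N$. -}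

module Defs where

open import Level using (Level; _⊔_) renaming (suc to lsuc)
open import Algebra.Bundles using (CommutativeRing)
import Algebra.Properties.CommutativeMonoid.Sum as Summation
open import Data.Bool.Base using (Bool; T; if_then_else_)
open import Data.Fin.Base using (Fin)
open import Data.Fin.Subset using (Subset; inside; outside; ⊤; ⊥)
open import Data.Nat.Base using (ℕ; zero; suc)
open import Data.Product using (Σ; ∃; ∃-syntax; ∃!; _×_; _,_; proj₁)
open import Data.Vec.Base using ([]; _∷_; lookup)
open import Function.Base using (_∘_)
open import Relation.Binary.Core using (Rel)
open import Relation.Binary.PropositionalEquality.Core using (_≡_; _≢_)
open import Relation.Binary.Structures using (IsDecTotalOrder)
open import Relation.Nullary.Negation using (¬_)
open import Relation.Unary using (Pred; _⊂_)

-- The real numbers of classical mathematics, given by the axioms of a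
-- Dedekind-complete ordered field, which determine ℝ up to isomorphism.  The
-- order is decidable and completeness holds for arbitrary predicates, as in
-- classical mathematics; constructive presentations of the reals do not in
-- general satisfy these axioms.

record Reals (c ℓ₁ ℓ₂ : Level) : Set (lsuc (c ⊔ ℓ₁ ⊔ ℓ₂)) where
  infix 4 _≤_ _<_
  field
    commutativeRing : CommutativeRing c ℓ₁

  open CommutativeRing commutativeRing public

  field
    _≤_             : Rel Carrier ℓ₂
    isDecTotalOrder : IsDecTotalOrder _≈_ _≤_
    0≉1             : ¬ (0# ≈ 1#)
    inverse         : ∀ x → ¬ (x ≈ 0#) → ∃[ y ] x * y ≈ 1#
    +-monoˡ-≤       : ∀ {x y} z → x ≤ y → x + z ≤ y + z
    *-nonNeg        : ∀ {x y} → 0# ≤ x → 0# ≤ y → 0# ≤ x * y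

  _<_ : Rel Carrier (ℓ₁ ⊔ ℓ₂)
  x < y = x ≤ y × ¬ (x ≈ y)

  UpperBound : Pred Carrier (c ⊔ ℓ₁ ⊔ ℓ₂) → Pred Carrier (c ⊔ ℓ₁ ⊔ ℓ₂)
  UpperBound P b = ∀ x → P x → x ≤ b

  field
    complete : ∀ (P : Pred Carrier (c ⊔ ℓ₁ ⊔ ℓ₂)) → ∃ P → ∃ (UpperBound P) →
               ∃[ s ] UpperBound P s × (∀ b → UpperBound P b → s ≤ b)

-- The finite set N is Fin n, so that 𝒫(N) is Subset n, with ⊤ for N and ⊥ for
-- ∅.  A set system is a subset of 𝒫(N), given by its indicator function.

SetSystem : ℕ → Set
SetSystem n = Subset n → Bool

infix 4 _∈ˢ_ _∉ˢ_ _⊂ˢ_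

_∈ˢ_ _∉ˢ_ : ∀ {n} → Subset n → SetSystem n → Set
S ∈ˢ 𝒮 = T (𝒮 S)
S ∉ˢ 𝒮 = ¬ (S ∈ˢ 𝒮)

_⊂ˢ_ : ∀ {n} → SetSystem n → SetSystem n → Set
𝒞 ⊂ˢ 𝒮 = (_∈ˢ 𝒞) ⊂ (_∈ˢ 𝒮)

NonTrivial : ∀ {n} → SetSystem n → Set
NonTrivial 𝒮 = (∃[ S ] S ∈ˢ 𝒮) × (⊥ ∉ˢ 𝒮) × (⊤ ∉ˢ 𝒮)

module Games {c ℓ₁ ℓ₂ : Level} (ℝ : Reals c ℓ₁ ℓ₂) where

  open Reals ℝ public using (Carrier; _≤_; 0#)
  open Reals ℝ hiding (Carrier; _≤_; 0#)
  open Summation +-commutativeMonoid using (sum)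

  module _ {n : ℕ} where

    -- Vectors in ℝ^N and in ℝ^𝒫(N).

    Vector SetVector : Set c
    Vector    = Fin n → Carrier
    SetVector = Subset n → Carrier

    infix 4 _≋_
    _≋_ : Rel SetVector ℓ₁
    θ ≋ θ′ = ∀ S → θ S ≈ θ′ S

    χ : Subset n → Vector
    χ S i = if lookup S i then 1# else 0#

  Σ⊆ : ∀ {n} → (Subset n → Carrier) → Carrier
  Σ⊆ {zero}  f = f []
  Σ⊆ {suc n} f = Σ⊆ (f ∘ (outside ∷_)) + Σ⊆ (f ∘ (inside ∷_))

  module _ {n : ℕ} where

    Σ[_] : SetSystem n → (Subset n → Carrier) → Carrier
    Σ[ 𝒮 ] f = Σ⊆ (λ S → if 𝒮 S then f S else 0#)

    ⟨_,_⟩ : SetVector {n} → SetVector {n} → Carrier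
    ⟨ θ , m ⟩ = Σ⊆ (λ S → θ S * m S)

    -- The coefficients of a combination of { χ S : S ∈ 𝒮 } are the values of
    -- λ′ at the members of 𝒮; the other values of λ′ are irrelevant.

    combination : SetSystem n → SetVector {n} → Vector {n}
    combination 𝒮 λ′ i = Σ[ 𝒮 ] (λ S → λ′ S * χ S i)

    YieldsConstant : SetSystem n → SetVector {n} → Carrier → Set ℓ₁
    YieldsConstant 𝒮 λ′ r = ∀ i → combination 𝒮 λ′ i ≈ r

    Affine : SetSystem n → SetVector {n} → Set ℓ₁
    Affine 𝒮 λ′ = Σ[ 𝒮 ] λ′ ≈ 1#

    SemiConic : SetSystem n → SetVector {n} → Set (ℓ₁ ⊔ ℓ₂)
    SemiConic 𝒮 λ′ = ∀ S S′ → S ∈ˢ 𝒮 → S′ ∈ˢ 𝒮 →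
                     λ′ S < 0# → λ′ S′ < 0# → S ≡ S′

    SemiBalanced : SetSystem n → Set (c ⊔ ℓ₁ ⊔ ℓ₂)
    SemiBalanced 𝒮 =
      NonTrivial 𝒮 ×
      ∃[ r ] ∃[ λ′ ] (SemiConic 𝒮 λ′ ×
                      (∀ S → S ∈ˢ 𝒮 → ¬ (λ′ S ≈ 0#)) ×
                      YieldsConstant 𝒮 λ′ r)

    MinSemiBalanced : SetSystem n → Set (c ⊔ ℓ₁ ⊔ ℓ₂)
    MinSemiBalanced 𝒮 =
      SemiBalanced 𝒮 × (∀ (𝒞 : SetSystem n) → 𝒞 ⊂ˢ 𝒮 → ¬ SemiBalanced 𝒞)

    record Assigned (𝒮 : SetSystem n) (λ′ : SetVector {n}) (r : Carrier)
                    (θ : SetVector {n}) : Set ℓ₁ where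
      field
        on-𝒮      : ∀ S → S ∈ˢ 𝒮 → θ S ≈ - λ′ S
        on-N      : θ ⊤ ≈ r
        on-∅      : θ ⊥ ≈ 1# - r
        elsewhere : ∀ L → L ∉ˢ 𝒮 → L ≢ ⊤ → L ≢ ⊥ → θ L ≈ 0#

    Θ : SetSystem n → Pred (SetVector {n}) (c ⊔ ℓ₁ ⊔ ℓ₂)
    Θ 𝒮 θ = ∃[ λ′ ] ∃[ r ] (Affine 𝒮 λ′ × SemiConic 𝒮 λ′ ×
                            YieldsConstant 𝒮 λ′ r × Assigned 𝒮 λ′ r θ)

    -- P holds of θ_𝒮: Θ 𝒮 has exactly one element, and P holds of it.

    Forθ : ∀ {p} → SetSystem n → Pred (SetVector {n}) p → Set (c ⊔ ℓ₁ ⊔ ℓ₂ ⊔ p)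
    Forθ 𝒮 P = Σ (∃! _≋_ (Θ 𝒮)) (P ∘ proj₁)

    IsGame : Pred (SetVector {n}) ℓ₁
    IsGame m = m ⊥ ≈ 0#

    _⟨_⟩ : Vector {n} → Subset n → Carrier
    x ⟨ S ⟩ = sum (λ i → if lookup S i then x i else 0#)

    Core : SetVector {n} → Pred (Vector {n}) (ℓ₁ ⊔ ℓ₂)
    Core m x = sum x ≈ m ⊤ × (∀ S → m S ≤ x ⟨ S ⟩)

    -- Membership in ℰ(N).
    Exact : Pred (SetVector {n}) (c ⊔ ℓ₁ ⊔ ℓ₂)
    Exact m = IsGame m × (∀ S → ∃[ x ] (Core m x × x ⟨ S ⟩ ≈ m S))

{-# OPTIONS --safe #-}
-- In homogeneous form, conditions (ii) and (iii) say that ⟨ w , m ⟩ ≤ r m(N) for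
-- every combination w of incidence vectors of non-trivial sets that yields the
-- constant vector r and has at most one negative coefficient, at a set U say.
-- A non-zero such w has a positive total, so that it can be made affine.  For
-- fixed U these inequalities are, by Farkas' lemma, the consistency conditions
-- for a core element that is tight at U, hence the equivalence with exactness.
-- If w and v are two such combinations, subtracting the largest multiple of v
-- that keeps the coefficients of w off U non-negative kills a coefficient of w:
-- this reduces the inequality to min-semi-balanced supports, and shows that on
-- those an affine combination is unique.

module Submission where

open import Level using (Level; _⊔_)
open import Algebra.Bundles using (CommutativeRing; RawRing)
import Algebra.Properties.Ring as RingProperties
import Algebra.Properties.Semiring.Mult.TCOptimised as Multiples
import Algebra.Properties.Semiring.Sum as Summation
import Algebra.Solver.Ring as RingSolver
open import Algebra.Solver.Ring.AlmostCommutativeRing using (fromCommutativeRing; _-Raw-AlmostCommutative⟶_; Induced-equivalence)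
open import Data.Bool.Base using (true; false; not; if_then_else_)
import Data.Bool.Properties as Boolₚ
open import Data.Empty using (⊥-elim)
open import Data.Fin.Base using (Fin; zero; suc)
open import Data.Fin.Subset using (Subset; inside; outside; ⊤; ⊥)
open import Data.Fin.Subset.Properties using (anySubset?)
open import Data.Integer.Base as ℤ using (ℤ; +_; -[1+_]; _⊖_; _◃_)
import Data.Integer.Properties as ℤₚ
open import Data.List.Base using (List; []; _∷_; _++_; map; filter; cartesianProductWith)
import Data.List.Extrema as Extrema
open import Data.List.Membership.Propositional using (_∈_)
open import Data.List.Membership.Propositional.Properties using (∈-++⁺ˡ; ∈-++⁺ʳ; ∈-map⁺; ∈-filter⁺; ∈-cartesianProductWith⁺)
open import Data.List.Relation.Unary.All as All using (All; []; _∷_)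
import Data.List.Relation.Unary.All.Properties as Allₚ
open import Data.List.Relation.Unary.Any using (here)
open import Data.Maybe.Base using (just; nothing)
open import Data.Nat.Base as ℕ using (ℕ; zero; suc)
open import Data.Nat.Induction using (<-wellFounded)
import Data.Nat.Properties as ℕₚ
open import Data.Product using (∃-syntax; _×_; _,_; proj₁; proj₂)
open import Data.Sign.Base as Sign using ()
open import Data.Sum.Base using (_⊎_; inj₁; inj₂)
open import Data.Vec.Base using ([]; _∷_; lookup)
import Data.Vec.Functional as F
import Data.Vec.Properties as Vecₚ
open import Function.Base using (_∘_)
open import Function.Bundles using (_⇔_; mk⇔)
open import Induction.WellFounded using (Acc; acc)
open import Relation.Binary.Bundles using (DecTotalOrder)
open import Relation.Binary.Definitions using (WeaklyDecidable)
open import Relation.Binary.PropositionalEquality as ≡ using (_≡_; _≢_)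
import Relation.Binary.Reasoning.PartialOrder as PartialOrderReasoning
import Relation.Binary.Reasoning.Setoid as SetoidReasoning
open import Relation.Binary.Structures using (IsDecTotalOrder)
open import Relation.Nullary.Decidable using (Dec; yes; no; does; _×-dec_; ¬?; T?; decidable-stable)
open import Relation.Nullary.Negation.Core using (¬_; contradiction)
open import Relation.Unary using (Pred)
open import Defs

-- Semi-conicity comes from tightness. A core element tight at `U` solves linear inequalities of
-- which those at `U` and at N are equalities, so their Farkas multipliers have free sign: the
-- multiplier at `U` is the one coefficient that may be negative, and the multiplier at N becomes,
-- up to sign, the constant r. The obstacle lies in the passage to minimal systems. For fixed `U`
-- the combinations form a convex cone, but a smaller semi-balanced system inside the support of w
-- may bring a combination v whose negative coefficient sits at another set. The pivot w - t v with
-- t ≥ 0 is insensitive to this: where v is negative the coefficients only grow, and only sets off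
-- `U` with v positive bound t. What has to be guaranteed is that one such set exists, and this is a
-- second use of the positive total.

module IntegerCoefficients {c ℓ} (R : CommutativeRing c ℓ) where

  open CommutativeRing R
  open RingProperties ring
  open Multiples semiring using (×-homo-+; ×1-homo-*; 1+×) renaming (_×_ to _×ℕ_)
  open SetoidReasoning setoid

  -- The solver has to compare numerals by computation, and equality in an abstract ring does not
  -- reduce; hence coefficients in ℤ. This variant of `_×ℕ_` makes `1 ×ℕ x` equal to `x` by
  -- definition, so that `con (+ 1)` denotes `1#` itself in solver goals.
  ⟦_⟧ℤ : ℤ → Carrier
  ⟦ + n ⟧ℤ      = n ×ℕ 1#
  ⟦ -[1+ n ] ⟧ℤ = - (suc n ×ℕ 1#)

  -‿homo : ∀ i → ⟦ ℤ.- i ⟧ℤ ≈ - ⟦ i ⟧ℤ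
  -‿homo (+ zero)   = sym -0#≈0#
  -‿homo (+ suc n)  = refl
  -‿homo (-[1+ n ]) = sym (-‿involutive _)

  ⊖-homo : ∀ m n → ⟦ m ⊖ n ⟧ℤ ≈ m ×ℕ 1# - n ×ℕ 1#
  ⊖-homo zero    zero    = sym (-‿inverseʳ 0#)
  ⊖-homo zero    (suc n) = sym (+-identityˡ _)
  ⊖-homo (suc m) zero    = sym (trans (+-congˡ -0#≈0#) (+-identityʳ _))
  ⊖-homo (suc m) (suc n) = begin
    ⟦ suc m ⊖ suc n ⟧ℤ              ≡⟨ ≡.cong ⟦_⟧ℤ (ℤₚ.[1+m]⊖[1+n]≡m⊖n m n) ⟩
    ⟦ m ⊖ n ⟧ℤ                      ≈⟨ ⊖-homo m n ⟩
    a - b                           ≈⟨ +-congʳ (+-identityʳ a) ⟨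
    (a + 0#) - b                    ≈⟨ +-congʳ (+-congˡ (-‿inverseʳ 1#)) ⟨
    (a + (1# - 1#)) - b             ≈⟨ +-congʳ (+-assoc a 1# (- 1#)) ⟨
    ((a + 1#) - 1#) - b             ≈⟨ +-assoc _ _ _ ⟩
    (a + 1#) + (- 1# - b)           ≈⟨ +-cong (+-comm a 1#) (-‿+-comm 1# b) ⟩
    (1# + a) - (1# + b)             ≈⟨ +-cong (1+× m 1#) (-‿cong (1+× n 1#)) ⟨
    suc m ×ℕ 1# - suc n ×ℕ 1#       ∎
    where a = m ×ℕ 1#
          b = n ×ℕ 1#

  +-homo : ∀ i j → ⟦ i ℤ.+ j ⟧ℤ ≈ ⟦ i ⟧ℤ + ⟦ j ⟧ℤ
  +-homo (+ m)    (+ n)    = ×-homo-+ 1# m n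
  +-homo (+ m)    -[1+ n ] = ⊖-homo m (suc n)
  +-homo -[1+ m ] (+ n)    = trans (⊖-homo n (suc m)) (+-comm _ _)
  +-homo -[1+ m ] -[1+ n ] = begin
    - (suc (suc (m ℕ.+ n)) ×ℕ 1#)            ≡⟨ ≡.cong (λ k → - (k ×ℕ 1#)) (ℕₚ.+-suc (suc m) n) ⟨
    - ((suc m ℕ.+ suc n) ×ℕ 1#)              ≈⟨ -‿cong (×-homo-+ 1# (suc m) (suc n)) ⟩
    - (suc m ×ℕ 1# + suc n ×ℕ 1#)            ≈⟨ -‿+-comm _ _ ⟨
    - (suc m ×ℕ 1#) - suc n ×ℕ 1#            ∎

  ◃⁺-homo : ∀ n → ⟦ Sign.+ ◃ n ⟧ℤ ≈ n ×ℕ 1#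
  ◃⁺-homo zero    = refl
  ◃⁺-homo (suc n) = refl

  ◃⁻-homo : ∀ n → ⟦ Sign.- ◃ n ⟧ℤ ≈ - (n ×ℕ 1#)
  ◃⁻-homo zero    = sym -0#≈0#
  ◃⁻-homo (suc n) = refl

  *-homo : ∀ i j → ⟦ i ℤ.* j ⟧ℤ ≈ ⟦ i ⟧ℤ * ⟦ j ⟧ℤ
  *-homo (+ m)    (+ n)    = trans (◃⁺-homo (m ℕ.* n)) (×1-homo-* m n)
  *-homo (+ m)    -[1+ n ] =
    trans (◃⁻-homo (m ℕ.* suc n)) (trans (-‿cong (×1-homo-* m (suc n))) (-‿distribʳ-* _ _))
  *-homo -[1+ m ] (+ n)    =
    trans (◃⁻-homo (suc m ℕ.* n)) (trans (-‿cong (×1-homo-* (suc m) n)) (-‿distribˡ-* _ _))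
  *-homo -[1+ m ] -[1+ n ] = begin
    ⟦ Sign.+ ◃ (suc m ℕ.* suc n) ⟧ℤ        ≈⟨ ◃⁺-homo (suc m ℕ.* suc n) ⟩
    (suc m ℕ.* suc n) ×ℕ 1#                ≈⟨ ×1-homo-* (suc m) (suc n) ⟩
    (suc m ×ℕ 1#) * (suc n ×ℕ 1#)          ≈⟨ -‿involutive _ ⟨
    - - ((suc m ×ℕ 1#) * (suc n ×ℕ 1#))    ≈⟨ -‿cong (-‿distribʳ-* _ _) ⟩
    - ((suc m ×ℕ 1#) * - (suc n ×ℕ 1#))    ≈⟨ -‿distribˡ-* _ _ ⟩
    - (suc m ×ℕ 1#) * - (suc n ×ℕ 1#)      ∎

  ℤ-rawRing : RawRing _ _
  ℤ-rawRing = record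
    { Carrier = ℤ ; _≈_ = _≡_ ; _+_ = ℤ._+_ ; _*_ = ℤ._*_ ; -_ = ℤ.-_ ; 0# = + 0 ; 1# = + 1 }

  morphism : ℤ-rawRing -Raw-AlmostCommutative⟶ fromCommutativeRing R
  morphism = record
    { ⟦_⟧ = ⟦_⟧ℤ ; +-homo = +-homo ; *-homo = *-homo ; -‿homo = -‿homo
    ; 0-homo = refl ; 1-homo = refl }

  _coeff≟_ : WeaklyDecidable (Induced-equivalence morphism)
  i coeff≟ j with i ℤₚ.≟ j
  ... | yes ≡.refl = just refl
  ... | no  _      = nothing

  open RingSolver ℤ-rawRing (fromCommutativeRing R) morphism _coeff≟_ public
    using (solve; _:=_; _:+_; _:*_; _:-_; :-_; con)

-- Ordered-field arithmetic and sums over all subsets.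

module OrderedField {c ℓ₁ ℓ₂ : Level} (ℝ : Reals c ℓ₁ ℓ₂) where

  open Games ℝ using (Σ⊆)
  open Reals ℝ hiding (zero)
  open IntegerCoefficients commutativeRing public using (solve; _:=_; _:+_; _:*_; _:-_; :-_; con)
  open RingProperties ring public using (-0#≈0#)
  open Summation semiring public using (sum; sum-cong-≋; ∑-distrib-+; *-distribˡ-sum)
  open IsDecTotalOrder isDecTotalOrder public
    using (_≟_; _≤?_; total; antisym)
    renaming (refl to ≤-refl; trans to ≤-trans; reflexive to ≤-reflexive)

  decTotalOrder : DecTotalOrder c ℓ₁ ℓ₂
  decTotalOrder = record { isDecTotalOrder = isDecTotalOrder }

  open DecTotalOrder decTotalOrder public using (poset; totalOrder)
  open PartialOrderReasoning poset public

  ≰⇒≥ : ∀ {x y} → ¬ (x ≤ y) → y ≤ x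
  ≰⇒≥ {x} {y} x≰y with total x y
  ... | inj₁ x≤y = contradiction x≤y x≰y
  ... | inj₂ y≤x = y≤x

  ≤∧≉⇒≱ : ∀ {x y} → x ≤ y → ¬ (x ≈ y) → ¬ (y ≤ x)
  ≤∧≉⇒≱ x≤y x≉y y≤x = x≉y (antisym x≤y y≤x)

  +-mono-≤ : ∀ {x y u v} → x ≤ y → u ≤ v → x + u ≤ y + v
  +-mono-≤ {x} {y} {u} {v} x≤y u≤v = begin
    x + u  ≤⟨ +-monoˡ-≤ u x≤y ⟩
    y + u  ≈⟨ +-comm y u ⟩
    u + y  ≤⟨ +-monoˡ-≤ y u≤v ⟩
    v + y  ≈⟨ +-comm v y ⟩
    y + v  ∎

  +-nonNeg : ∀ {x y} → 0# ≤ x → 0# ≤ y → 0# ≤ x + y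
  +-nonNeg 0≤x 0≤y = ≤-trans (≤-reflexive (sym (+-identityʳ 0#))) (+-mono-≤ 0≤x 0≤y)

  x≤y⇒0≤y-x : ∀ {x y} → x ≤ y → 0# ≤ y - x
  x≤y⇒0≤y-x {x} {y} x≤y = ≤-trans (≤-reflexive (sym (-‿inverseʳ x))) (+-monoˡ-≤ (- x) x≤y)

  0≤y-x⇒x≤y : ∀ {x y} → 0# ≤ y - x → x ≤ y
  0≤y-x⇒x≤y {x} {y} 0≤y-x = begin
    x              ≈⟨ +-identityˡ x ⟨
    0# + x         ≤⟨ +-monoˡ-≤ x 0≤y-x ⟩
    (y - x) + x    ≈⟨ solve 2 (λ x y → (y :- x) :+ x := y) refl x y ⟩
    y              ∎

  -- Reduces the rearrangement of an inequality to an identity between differences, which the ring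
  -- solver settles.
  ≤-shift : ∀ {x y u v} → y - x ≈ v - u → x ≤ y → u ≤ v
  ≤-shift y-x≈v-u x≤y = 0≤y-x⇒x≤y (≤-trans (x≤y⇒0≤y-x x≤y) (≤-reflexive y-x≈v-u))

  neg-nonPos : ∀ {x} → x ≤ 0# → 0# ≤ - x
  neg-nonPos {x} x≤0 = ≤-trans (x≤y⇒0≤y-x x≤0) (≤-reflexive (+-identityˡ (- x)))

  neg-nonNeg : ∀ {x} → 0# ≤ x → - x ≤ 0#
  neg-nonNeg {x} 0≤x = 0≤y-x⇒x≤y (≤-trans 0≤x (≤-reflexive (solve 1 (λ x → x := con (+ 0) :- (:- x)) refl x)))

  *-monoˡ-≤ : ∀ {x y z} → 0# ≤ z → x ≤ y → z * x ≤ z * y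
  *-monoˡ-≤ {x} {y} {z} 0≤z x≤y = 0≤y-x⇒x≤y (≤-trans (*-nonNeg 0≤z (x≤y⇒0≤y-x x≤y))
    (≤-reflexive (solve 3 (λ x y z → z :* (y :- x) := z :* y :- z :* x) refl x y z)))

  0≤1 : 0# ≤ 1#
  0≤1 with total 0# 1#
  ... | inj₁ 0≤1 = 0≤1
  ... | inj₂ 1≤0 = ≤-trans (*-nonNeg (neg-nonPos 1≤0) (neg-nonPos 1≤0))
                     (≤-reflexive (solve 0 ((:- con (+ 1)) :* (:- con (+ 1)) := con (+ 1)) refl))

  -- Junk value: 0# ⁻¹ is 0#.
  infix 9 _⁻¹
  _⁻¹ : Carrier → Carrier
  x ⁻¹ with x ≟ 0#
  ... | yes _  = 0#
  ... | no x≉0 = proj₁ (inverse x x≉0)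

  *-inverseʳ : ∀ {x} → ¬ (x ≈ 0#) → x * x ⁻¹ ≈ 1#
  *-inverseʳ {x} x≉0 with x ≟ 0#
  ... | yes x≈0 = contradiction x≈0 x≉0
  ... | no x≉0  = proj₂ (inverse x x≉0)

  ⁻¹-nonNeg : ∀ {x} → 0# ≤ x → 0# ≤ x ⁻¹
  ⁻¹-nonNeg {x} 0≤x with x ≟ 0#
  ... | yes _  = ≤-refl
  ... | no x≉0 with inverse x x≉0
  ...   | y , xy≈1 with total 0# y
  ...     | inj₁ 0≤y = 0≤y
  ...     | inj₂ y≤0 = contradiction (begin
    1#            ≈⟨ xy≈1 ⟨
    x * y         ≈⟨ solve 2 (λ x y → x :* y := :- (x :* :- y)) refl x y ⟩
    - (x * - y)   ≤⟨ neg-nonNeg (*-nonNeg 0≤x (neg-nonPos y≤0)) ⟩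
    0#            ∎) (≤∧≉⇒≱ 0≤1 0≉1)

  Σ⊆-cong : ∀ {n} {f g : Subset n → Carrier} → (∀ S → f S ≈ g S) → Σ⊆ f ≈ Σ⊆ g
  Σ⊆-cong {zero}  f≈g = f≈g []
  Σ⊆-cong {suc n} f≈g = +-cong (Σ⊆-cong (f≈g ∘ (outside ∷_))) (Σ⊆-cong (f≈g ∘ (inside ∷_)))

  Σ⊆-mono : ∀ {n} {f g : Subset n → Carrier} → (∀ S → f S ≤ g S) → Σ⊆ f ≤ Σ⊆ g
  Σ⊆-mono {zero}  f≤g = f≤g []
  Σ⊆-mono {suc n} f≤g = +-mono-≤ (Σ⊆-mono (f≤g ∘ (outside ∷_))) (Σ⊆-mono (f≤g ∘ (inside ∷_)))

  Σ⊆-zero : ∀ n → Σ⊆ {n} (λ _ → 0#) ≈ 0#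
  Σ⊆-zero zero    = refl
  Σ⊆-zero (suc n) = trans (+-cong (Σ⊆-zero n) (Σ⊆-zero n)) (+-identityʳ 0#)

  Σ⊆-linear : ∀ {n} (f g : Subset n → Carrier) t → Σ⊆ (λ S → f S + t * g S) ≈ Σ⊆ f + t * Σ⊆ g
  Σ⊆-linear {zero}  f g t = refl
  Σ⊆-linear {suc n} f g t = trans
    (+-cong (Σ⊆-linear (f ∘ (outside ∷_)) (g ∘ (outside ∷_)) t)
            (Σ⊆-linear (f ∘ (inside ∷_)) (g ∘ (inside ∷_)) t))
    (solve 5 (λ a b c d t → (a :+ t :* b) :+ (c :+ t :* d) := (a :+ c) :+ t :* (b :+ d)) refl
      (Σ⊆ (f ∘ (outside ∷_))) (Σ⊆ (g ∘ (outside ∷_))) (Σ⊆ (f ∘ (inside ∷_))) (Σ⊆ (g ∘ (inside ∷_))) t)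

  Σ⊆-scale : ∀ {n} (f : Subset n → Carrier) t → Σ⊆ (λ S → t * f S) ≈ t * Σ⊆ f
  Σ⊆-scale {n} f t = begin-equality
    Σ⊆ (λ S → t * f S)               ≈⟨ Σ⊆-cong (λ S → +-identityˡ (t * f S)) ⟨
    Σ⊆ (λ S → 0# + t * f S)          ≈⟨ Σ⊆-linear (λ _ → 0#) f t ⟩
    Σ⊆ {n} (λ _ → 0#) + t * Σ⊆ f     ≈⟨ +-congʳ (Σ⊆-zero n) ⟩
    0# + t * Σ⊆ f                    ≈⟨ +-identityˡ (t * Σ⊆ f) ⟩
    t * Σ⊆ f                         ∎

  Σ⊆-nonNeg : ∀ {n} {f : Subset n → Carrier} → (∀ S → 0# ≤ f S) → 0# ≤ Σ⊆ f
  Σ⊆-nonNeg {n} 0≤f = ≤-trans (≤-reflexive (sym (Σ⊆-zero n))) (Σ⊆-mono 0≤f)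

  Σ⊆-nonNeg≤0⇒zero : ∀ {n} {f : Subset n → Carrier} → (∀ S → 0# ≤ f S) → Σ⊆ f ≤ 0# → ∀ S → f S ≈ 0#
  Σ⊆-nonNeg≤0⇒zero {zero} 0≤f Σ≤0 [] = antisym Σ≤0 (0≤f [])
  Σ⊆-nonNeg≤0⇒zero {suc n} {f} 0≤f Σ≤0 (outside ∷ S) = Σ⊆-nonNeg≤0⇒zero (0≤f ∘ (outside ∷_))
    (≤-trans (≤-trans (≤-reflexive (sym (+-identityʳ _)))
      (+-mono-≤ ≤-refl (Σ⊆-nonNeg (0≤f ∘ (inside ∷_))))) Σ≤0) S
  Σ⊆-nonNeg≤0⇒zero {suc n} {f} 0≤f Σ≤0 (inside ∷ S) = Σ⊆-nonNeg≤0⇒zero (0≤f ∘ (inside ∷_))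
    (≤-trans (≤-trans (≤-reflexive (sym (+-identityˡ _)))
      (+-mono-≤ (Σ⊆-nonNeg (0≤f ∘ (outside ∷_))) ≤-refl)) Σ≤0) S

  Σ⊆-sum-comm : ∀ {n k} (f : Subset n → Fin k → Carrier) →
                Σ⊆ (λ S → sum (f S)) ≈ sum (λ i → Σ⊆ (λ S → f S i))
  Σ⊆-sum-comm {zero}  f = refl
  Σ⊆-sum-comm {suc n} f = trans
    (+-cong (Σ⊆-sum-comm (f ∘ (outside ∷_))) (Σ⊆-sum-comm (f ∘ (inside ∷_))))
    (sym (∑-distrib-+ (λ i → Σ⊆ (λ S → f (outside ∷ S) i)) (λ i → Σ⊆ (λ S → f (inside ∷ S) i))))

  -- The recursion follows that of `Σ⊆`: on the half of the subsets that disagree with the first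
  -- argument at the head, the value reduces to `0#`, so `Σ⊆-δ` is a plain induction.
  δ : ∀ {n} → Subset n → Subset n → Carrier
  δ []            []            = 1#
  δ (outside ∷ S) (outside ∷ T) = δ S T
  δ (inside ∷ S)  (inside ∷ T)  = δ S T
  δ (outside ∷ _) (inside ∷ _)  = 0#
  δ (inside ∷ _)  (outside ∷ _) = 0#

  δ-refl : ∀ {n} (S : Subset n) → δ S S ≡ 1#
  δ-refl []            = ≡.refl
  δ-refl (outside ∷ S) = δ-refl S
  δ-refl (inside ∷ S)  = δ-refl S

  δ-≢ : ∀ {n} {S T : Subset n} → S ≢ T → δ S T ≡ 0#
  δ-≢ {S = []}          {[]}          S≢T = contradiction ≡.refl S≢T
  δ-≢ {S = outside ∷ S} {outside ∷ T} S≢T = δ-≢ (S≢T ∘ ≡.cong (outside ∷_))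
  δ-≢ {S = inside ∷ S}  {inside ∷ T}  S≢T = δ-≢ (S≢T ∘ ≡.cong (inside ∷_))
  δ-≢ {S = outside ∷ _} {inside ∷ _}  _   = ≡.refl
  δ-≢ {S = inside ∷ _}  {outside ∷ _} _   = ≡.refl

  δ-nonNeg : ∀ {n} (S T : Subset n) → 0# ≤ δ S T
  δ-nonNeg []            []            = 0≤1
  δ-nonNeg (outside ∷ S) (outside ∷ T) = δ-nonNeg S T
  δ-nonNeg (inside ∷ S)  (inside ∷ T)  = δ-nonNeg S T
  δ-nonNeg (outside ∷ _) (inside ∷ _)  = ≤-refl
  δ-nonNeg (inside ∷ _)  (outside ∷ _) = ≤-refl

  Σ⊆-δ : ∀ {n} (T : Subset n) (f : Subset n → Carrier) → Σ⊆ (λ S → δ T S * f S) ≈ f T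
  Σ⊆-δ {zero}  []            f = *-identityˡ (f [])
  Σ⊆-δ {suc n} (outside ∷ T) f = trans
    (+-cong (Σ⊆-δ T (f ∘ (outside ∷_))) (trans (Σ⊆-scale (f ∘ (inside ∷_)) 0#) (zeroˡ _))) (+-identityʳ _)
  Σ⊆-δ {suc n} (inside ∷ T)  f = trans
    (+-cong (trans (Σ⊆-scale (f ∘ (outside ∷_)) 0#) (zeroˡ _)) (Σ⊆-δ T (f ∘ (inside ∷_)))) (+-identityˡ _)

-- Linear inequalities and Farkas' lemma.

module FourierMotzkin {c ℓ₁ ℓ₂ : Level} (ℝ : Reals c ℓ₁ ℓ₂) where

  open Reals ℝ hiding (zero)
  open OrderedField ℝ
  open Extrema totalOrder using
    (argmin; argmax; f[argmin]≤f[xs]; f[argmin]≤f[⊤]; f[xs]≤f[argmax]; f[⊥]≤f[argmax]; f[argmax]≤v⁺)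

  infix 7 _·_

  _·_ : ∀ {n} → F.Vector Carrier n → F.Vector Carrier n → Carrier
  a · x = sum (λ i → a i * x i)

  ·-+ : ∀ {n} (a b x : F.Vector Carrier n) → (λ i → a i + b i) · x ≈ a · x + b · x
  ·-+ a b x = trans (sum-cong-≋ (λ i → distribʳ (x i) (a i) (b i))) (∑-distrib-+ (λ i → a i * x i) (λ i → b i * x i))

  ·-* : ∀ {n} t (a x : F.Vector Carrier n) → (λ i → t * a i) · x ≈ t * (a · x)
  ·-* t a x = trans (sum-cong-≋ (λ i → *-assoc t (a i) (x i))) (sym (*-distribˡ-sum t (λ i → a i * x i)))

  Constraint : ℕ → Set c
  Constraint n = F.Vector Carrier n × Carrier

  Satisfies : ∀ {n} → F.Vector Carrier n → Pred (Constraint n) ℓ₂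
  Satisfies x (a , b) = b ≤ a · x

  -- Keeping the set of consequences abstract spares the elimination from carrying multipliers
  -- along: instantiated with `Derivable`, membership of the contradictory constraint itself
  -- supplies them.
  record IsCone {n p} (P : Pred (Constraint n) p) : Set (c ⊔ ℓ₁ ⊔ ℓ₂ ⊔ p) where
    field
      resp  : ∀ {a a′ b b′} → (∀ i → a i ≈ a′ i) → b ≈ b′ → P (a , b) → P (a′ , b′)
      add   : ∀ {a a′ b b′} → P (a , b) → P (a′ , b′) → P ((λ i → a i + a′ i) , b + b′)
      scale : ∀ {t a b} → 0# ≤ t → P (a , b) → P ((λ i → t * a i) , t * b)

  prepend : ∀ {n} → Carrier → Constraint n → Constraint (suc n)
  prepend e (a , b) = e F.∷ a , b

  -- The largest lower bound serves if there is one, otherwise the smallest upper bound.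
  between : ∀ {p q} {A : Set p} {B : Set q} (f : A → Carrier) (g : B → Carrier) ps qs →
            All (λ x → All (λ y → f x ≤ g y) qs) ps →
            ∃[ z ] All (λ x → f x ≤ z) ps × All (λ y → z ≤ g y) qs
  between f g []       []       _ = 0# , [] , []
  between f g []       (y ∷ qs) _ =
    g (argmin g y qs) , [] , f[argmin]≤f[⊤] {f = g} y qs ∷ f[argmin]≤f[xs] {f = g} y qs
  between f g (x ∷ ps) qs       (x≤qs ∷ ps≤qs) =
    f (argmax f x ps) , f[⊥]≤f[argmax] {f = f} x ps ∷ f[xs]≤f[argmax] {f = f} x ps ,
    All.tabulate (λ y∈qs → f[argmax]≤v⁺ {f = f} {⊥ = x} {xs = ps}
      (All.lookup x≤qs y∈qs) (All.map (λ x≤qs → All.lookup x≤qs y∈qs) ps≤qs))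

  -- With leading coefficients 0, 1 and -1, eliminating the first variable amounts to adding a
  -- member of `ps` to a member of `ns`. The field `sound` carries a solution back to `L`.
  record Normalised {n p} (P : Pred (Constraint (suc n)) p) (L : List (Constraint (suc n))) : Set (c ⊔ ℓ₂ ⊔ p) where
    field
      zs ps ns : List (Constraint n)
      zs⊆P : All (P ∘ prepend 0#) zs
      ps⊆P : All (P ∘ prepend 1#) ps
      ns⊆P : All (P ∘ prepend (- 1#)) ns
      sound : ∀ x₀ x → let y = x₀ F.∷ x in
              All (Satisfies y ∘ prepend 0#) zs → All (Satisfies y ∘ prepend 1#) ps →
              All (Satisfies y ∘ prepend (- 1#)) ns → All (Satisfies y) L

  module _ {n p} {P : Pred (Constraint (suc n)) p} (cone : IsCone P) where
    open IsCone cone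

    -- In its uses `t` is the absolute value of the leading coefficient, `e` the sign and `u` the
    -- inverse of `t`. Scaling by `u` stays in the cone; scaling by `t` undoes it on solutions.
    rescale : ∀ {a b} e {t u} → 0# ≤ t → 0# ≤ u → t * u ≈ 1# → a zero ≈ t * e → P (a , b) →
              let q = (λ i → u * a (suc i)) , u * b in
              P (prepend e q) × (∀ x → Satisfies x (prepend e q) → Satisfies x (a , b))
    rescale {a} {b} e {t} {u} 0≤t 0≤u tu≈1 a₀≈te Pab =
      resp (λ { zero → begin-equality
                  u * a zero   ≈⟨ *-congˡ a₀≈te ⟩
                  u * (t * e)  ≈⟨ solve 3 (λ e t u → u :* (t :* e) := (t :* u) :* e) refl e t u ⟩
                  (t * u) * e  ≈⟨ *-congʳ tu≈1 ⟩
                  1# * e       ≈⟨ *-identityˡ e ⟩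
                  e            ∎
              ; (suc i) → refl }) refl (scale 0≤u Pab) ,
      λ x sat → begin
        b                                   ≈⟨ *-identityˡ b ⟨
        1# * b                              ≈⟨ *-congʳ tu≈1 ⟨
        (t * u) * b                         ≈⟨ *-assoc t u b ⟩
        t * (u * b)                         ≤⟨ *-monoˡ-≤ 0≤t sat ⟩
        t * (e * x zero + (λ i → u * a (suc i)) · (x ∘ suc))
          ≈⟨ *-congˡ (+-congˡ (·-* u (a ∘ suc) (x ∘ suc))) ⟩
        t * (e * x zero + u * ((a ∘ suc) · (x ∘ suc)))
          ≈⟨ solve 5 (λ t e x u d → t :* (e :* x :+ u :* d) := (t :* e) :* x :+ (t :* u) :* d) refl
                t e (x zero) u ((a ∘ suc) · (x ∘ suc)) ⟩
        (t * e) * x zero + (t * u) * ((a ∘ suc) · (x ∘ suc))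
          ≈⟨ +-cong (*-congʳ (sym a₀≈te)) (trans (*-congʳ tu≈1) (*-identityˡ _)) ⟩
        a zero * x zero + (a ∘ suc) · (x ∘ suc) ∎

    normalise : ∀ L → All P L → Normalised P L
    normalise [] [] = record
      { zs = [] ; ps = [] ; ns = [] ; zs⊆P = [] ; ps⊆P = [] ; ns⊆P = [] ; sound = λ _ _ _ _ _ → [] }
    normalise ((a , b) ∷ L) (Pab ∷ PL) with normalise L PL | a zero ≟ 0#
    ... | N | yes a₀≈0 = record
      { zs = (a ∘ suc , b) ∷ zs ; ps = ps ; ns = ns
      ; zs⊆P = resp (λ { zero → a₀≈0 ; (suc _) → refl }) refl Pab ∷ zs⊆P ; ps⊆P = ps⊆P ; ns⊆P = ns⊆P
      ; sound = λ { x₀ x (z ∷ zs) ps ns →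
          ≤-trans z (≤-reflexive (+-congʳ (*-congʳ (sym a₀≈0)))) ∷ sound x₀ x zs ps ns } }
      where open Normalised N
    ... | N | no a₀≉0 with total 0# (a zero)
    ...   | inj₁ 0≤a₀ = record
      { zs = zs ; ps = _ ∷ ps ; ns = ns ; zs⊆P = zs⊆P ; ps⊆P = proj₁ q ∷ ps⊆P ; ns⊆P = ns⊆P
      ; sound = λ { x₀ x zs (p ∷ ps) ns → proj₂ q (x₀ F.∷ x) p ∷ sound x₀ x zs ps ns } }
      where
      open Normalised N
      q = rescale 1# 0≤a₀ (⁻¹-nonNeg 0≤a₀) (*-inverseʳ a₀≉0) (sym (*-identityʳ (a zero))) Pab
    ...   | inj₂ a₀≤0 = record
      { zs = zs ; ps = ps ; ns = _ ∷ ns ; zs⊆P = zs⊆P ; ps⊆P = ps⊆P ; ns⊆P = proj₁ q ∷ ns⊆P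
      ; sound = λ { x₀ x zs ps (p ∷ ns) → proj₂ q (x₀ F.∷ x) p ∷ sound x₀ x zs ps ns } }
      where
      open Normalised N
      -a₀≉0 : ¬ (- a zero ≈ 0#)
      -a₀≉0 -a₀≈0 = a₀≉0 (begin-equality
        a zero       ≈⟨ solve 1 (λ a → a := :- (:- a)) refl (a zero) ⟩
        - (- a zero) ≈⟨ -‿cong -a₀≈0 ⟩
        - 0#         ≈⟨ -0#≈0# ⟩
        0#           ∎)
      q = rescale (- 1#) (neg-nonPos a₀≤0) (⁻¹-nonNeg (neg-nonPos a₀≤0)) (*-inverseʳ -a₀≉0)
            (solve 1 (λ a → a := (:- a) :* (:- con (+ 1))) refl (a zero)) Pab

  _⊕_ : ∀ {n} → Constraint n → Constraint n → Constraint n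
  (a , b) ⊕ (a′ , b′) = (λ i → a i + a′ i) , b + b′

  slice-cone : ∀ {n p} {P : Pred (Constraint (suc n)) p} → IsCone P → IsCone (P ∘ prepend 0#)
  slice-cone cone = record
    { resp  = λ a≈a′ → resp (λ { zero → refl ; (suc i) → a≈a′ i })
    ; add   = λ Pa Pa′ → resp (λ { zero → +-identityˡ 0# ; (suc i) → refl }) refl (add Pa Pa′)
    ; scale = λ {t} 0≤t Pa → resp (λ { zero → zeroʳ t ; (suc i) → refl }) refl (scale 0≤t Pa)
    }
    where open IsCone cone

  -- Farkas' lemma by elimination of variables; P plays the role of the conic
  -- consequences of L.
  farkas : ∀ n {p} {P : Pred (Constraint n) p} → IsCone P → ∀ L → All P L →
                    (∃[ x ] All (Satisfies x) L) ⊎ (∃[ b ] ¬ (b ≤ 0#) × P ((λ _ → 0#) , b))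
  farkas zero cone [] [] = inj₁ ((λ ()) , [])
  farkas zero cone ((a , b) ∷ L) (Pab ∷ PL) with b ≤? 0# | farkas zero cone L PL
  ... | no b≰0  | _                  = inj₂ (b , b≰0 , IsCone.resp cone (λ ()) refl Pab)
  ... | yes b≤0 | inj₁ (x , x⊨L)     = inj₁ (x , b≤0 ∷ x⊨L)
  ... | yes b≤0 | inj₂ contradictory = inj₂ contradictory
  farkas (suc n) {P = P} cone L PL = helper (farkas n (slice-cone cone) eliminated eliminated⊆P)
    where
    open IsCone cone
    open Normalised (normalise cone L PL)

    eliminated : List (Constraint n)
    eliminated = zs ++ cartesianProductWith _⊕_ ps ns

    eliminated⊆P : All (P ∘ prepend 0#) eliminated
    eliminated⊆P = Allₚ.++⁺ zs⊆P (Allₚ.cartesianProductWith⁺ (≡.setoid _) (≡.setoid _) _⊕_ ps ns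
      λ p∈ps q∈ns → resp (λ { zero → -‿inverseʳ 1# ; (suc _) → refl }) refl
        (add (All.lookup ps⊆P p∈ps) (All.lookup ns⊆P q∈ns)))

    helper : (∃[ x ] All (Satisfies x) eliminated) ⊎ (∃[ b ] ¬ (b ≤ 0#) × P (prepend 0# ((λ _ → 0#) , b))) →
             (∃[ x ] All (Satisfies x) L) ⊎ (∃[ b ] ¬ (b ≤ 0#) × P ((λ _ → 0#) , b))
    helper (inj₂ (b , b≰0 , P0b)) = inj₂ (b , b≰0 , resp (λ { zero → refl ; (suc _) → refl }) refl P0b)
    -- A constraint with leading coefficient 1 bounds the new variable below by `b - a · x`, one
    -- with -1 bounds it above by `a · x - b`. The sums in `eliminated` say that every lower bound
    -- is at most every upper bound, so a value in between exists.
    helper (inj₁ (x , x⊨))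
      with between (λ (a , b) → b - a · x) (λ (a , b) → a · x - b) ps ns
        (All.tabulate λ {(a , b)} p∈ps → All.tabulate λ {(a′ , b′)} q∈ns → ≤-shift
          (trans (+-congʳ (·-+ a a′ x))
            (solve 4 (λ d d′ b b′ → (d :+ d′) :- (b :+ b′) := (d′ :- b′) :- (b :- d)) refl (a · x) (a′ · x) b b′))
          (All.lookup (Allₚ.++⁻ʳ zs x⊨) (∈-cartesianProductWith⁺ _⊕_ p∈ps q∈ns)))
    ... | x₀ , lower , upper = inj₁ (x₀ F.∷ x , sound x₀ x
      (All.map (λ {(a , b)} → ≤-shift
        (solve 3 (λ d b x → d :- b := (con (+ 0) :* x :+ d) :- b) refl (a · x) b x₀)) (Allₚ.++⁻ˡ zs x⊨))
      (All.map (λ {(a , b)} → ≤-shift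
        (solve 3 (λ d b x → x :- (b :- d) := (con (+ 1) :* x :+ d) :- b) refl (a · x) b x₀)) lower)
      (All.map (λ {(a , b)} → ≤-shift
        (solve 3 (λ d b x → (d :- b) :- x := ((:- con (+ 1)) :* x :+ d) :- b) refl (a · x) b x₀)) upper))

-- Finite set systems and their cardinality.

infix 4 _≟ˢ_
_≟ˢ_ : ∀ {n} (S T : Subset n) → Dec (S ≡ T)
_≟ˢ_ = Vecₚ.≡-dec Boolₚ._≟_

differ : ∀ {n} {S T : Subset n} → S ≢ T → ∃[ i ] lookup S i ≢ lookup T i
differ {S = []}    {[]}    S≢T = contradiction ≡.refl S≢T
differ {S = a ∷ S} {b ∷ T} S≢T with a Boolₚ.≟ b
... | no a≢b     = zero , a≢b
... | yes ≡.refl with differ (S≢T ∘ ≡.cong (a ∷_))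
...   | i , Sᵢ≢Tᵢ = suc i , Sᵢ≢Tᵢ

subsets : ∀ n → List (Subset n)
subsets zero    = [] ∷ []
subsets (suc n) = map (outside ∷_) (subsets n) ++ map (inside ∷_) (subsets n)

∈-subsets : ∀ {n} (S : Subset n) → S ∈ subsets n
∈-subsets []            = here ≡.refl
∈-subsets (outside ∷ S) = ∈-++⁺ˡ (∈-map⁺ (outside ∷_) (∈-subsets S))
∈-subsets {suc n} (inside ∷ S)  = ∈-++⁺ʳ (map (outside ∷_) (subsets n)) (∈-map⁺ (inside ∷_) (∈-subsets S))

card : ∀ {n} → SetSystem n → ℕ
card {zero}  𝒮 = if 𝒮 [] then 1 else 0
card {suc n} 𝒮 = card (𝒮 ∘ (outside ∷_)) ℕ.+ card (𝒮 ∘ (inside ∷_))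

card-mono : ∀ {n} {𝒞 𝒮 : SetSystem n} → (∀ S → S ∈ˢ 𝒞 → S ∈ˢ 𝒮) → card 𝒞 ℕ.≤ card 𝒮
card-mono {zero} {𝒞} {𝒮} 𝒞⊆𝒮 with 𝒞 [] | 𝒮 [] | 𝒞⊆𝒮 []
... | false | _     | _ = ℕ.z≤n
... | true  | true  | _ = ℕₚ.≤-refl
... | true  | false | f = ⊥-elim (f _)
card-mono {suc n} 𝒞⊆𝒮 = ℕₚ.+-mono-≤ (card-mono (𝒞⊆𝒮 ∘ (outside ∷_))) (card-mono (𝒞⊆𝒮 ∘ (inside ∷_)))

card-strict : ∀ {n} {𝒞 𝒮 : SetSystem n} → (∀ S → S ∈ˢ 𝒞 → S ∈ˢ 𝒮) →
              ∀ S → S ∈ˢ 𝒮 → S ∉ˢ 𝒞 → card 𝒞 ℕ.< card 𝒮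
card-strict {zero} {𝒞} {𝒮} 𝒞⊆𝒮 [] S∈𝒮 S∉𝒞 with 𝒞 [] | 𝒮 []
... | true  | _     = contradiction _ S∉𝒞
... | false | true  = ℕ.s≤s ℕ.z≤n
... | false | false = ⊥-elim S∈𝒮
card-strict {suc n} 𝒞⊆𝒮 (outside ∷ S) S∈𝒮 S∉𝒞 =
  ℕₚ.+-mono-<-≤ (card-strict (𝒞⊆𝒮 ∘ (outside ∷_)) S S∈𝒮 S∉𝒞) (card-mono (𝒞⊆𝒮 ∘ (inside ∷_)))
card-strict {suc n} 𝒞⊆𝒮 (inside ∷ S) S∈𝒮 S∉𝒞 =
  ℕₚ.+-mono-≤-< (card-mono (𝒞⊆𝒮 ∘ (outside ∷_))) (card-strict (𝒞⊆𝒮 ∘ (inside ∷_)) S S∈𝒮 S∉𝒞)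

-- Strict inclusion provides only a negated universal statement; a decidable search through the
-- finitely many subsets extracts the witness that `card-strict` asks for.
⊈⇒∃ : ∀ {n} {𝒮 𝒞 : SetSystem n} → ¬ (∀ {S} → S ∈ˢ 𝒮 → S ∈ˢ 𝒞) → ∃[ S ] S ∈ˢ 𝒮 × S ∉ˢ 𝒞
⊈⇒∃ {𝒮 = 𝒮} {𝒞} 𝒮⊈𝒞 with anySubset? (λ S → T? (𝒮 S) ×-dec ¬? (T? (𝒞 S)))
... | yes found = found
... | no  none  = contradiction
  (λ {S} S∈𝒮 → decidable-stable (T? (𝒞 S)) (λ S∉𝒞 → none (S , S∈𝒮 , S∉𝒞))) 𝒮⊈𝒞

-- Balanced weights: positivity of the total, and pivoting.

module SemiConicCombinations {c ℓ₁ ℓ₂ : Level} (ℝ : Reals c ℓ₁ ℓ₂) where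

  open Reals ℝ hiding (zero; Carrier; _≤_; 0#)
  open Games ℝ
  open OrderedField ℝ

  ⟨⟩-congˡ : ∀ {n} {θ θ′ : SetVector {n}} m → θ ≋ θ′ → ⟨ θ , m ⟩ ≈ ⟨ θ′ , m ⟩
  ⟨⟩-congˡ m θ≋θ′ = Σ⊆-cong (λ S → *-congʳ (θ≋θ′ S))

  ⟨⟩-linear : ∀ {n} (w v : SetVector {n}) t m → ⟨ (λ S → w S + t * v S) , m ⟩ ≈ ⟨ w , m ⟩ + t * ⟨ v , m ⟩
  ⟨⟩-linear w v t m = trans
    (Σ⊆-cong (λ S → solve 4 (λ a b t x → (a :+ t :* b) :* x := a :* x :+ t :* (b :* x)) refl (w S) (v S) t (m S)))
    (Σ⊆-linear (λ S → w S * m S) (λ S → v S * m S) t)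

  ⟨⟩-scale : ∀ {n} (w : SetVector {n}) t m → ⟨ (λ S → t * w S) , m ⟩ ≈ t * ⟨ w , m ⟩
  ⟨⟩-scale w t m = trans (Σ⊆-cong (λ S → *-assoc t (w S) (m S))) (Σ⊆-scale (λ S → w S * m S) t)

  indicator-nonNeg : ∀ b → 0# ≤ (if b then 1# else 0#)
  indicator-nonNeg true  = 0≤1
  indicator-nonNeg false = ≤-refl

  1-indicator-nonNeg : ∀ b → 0# ≤ 1# - (if b then 1# else 0#)
  1-indicator-nonNeg true  = ≤-reflexive (sym (-‿inverseʳ 1#))
  1-indicator-nonNeg false = ≤-trans 0≤1 (≤-reflexive (solve 0 (con (+ 1) := con (+ 1) :- con (+ 0)) refl))

  χ-inside : ∀ {n} (S : Subset n) i → lookup S i ≡ true → χ S i ≡ 1#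
  χ-inside S i = ≡.cong (if_then 1# else 0#)

  χ-outside : ∀ {n} (S : Subset n) i → lookup S i ≡ false → χ S i ≡ 0#
  χ-outside S i = ≡.cong (if_then 1# else 0#)

  -- Weights live on the whole power set and the set system is recovered as their support, so that
  -- combinations over different systems can be added. Non-triviality of the system becomes
  -- vanishing at ∅ and N.
  record Balanced {n} (w : SetVector {n}) (r : Carrier) : Set ℓ₁ where
    field
      at-∅     : w ⊥ ≈ 0#
      at-N     : w ⊤ ≈ 0#
      constant : ∀ i → ⟨ w , (λ S → χ S i) ⟩ ≈ r

  -- The exceptional set is unrestricted: conic combinations are covered by any choice of it, and at
  -- ∅ or N a balanced weight vanishes anyway.
  NonNegOff : ∀ {n} → Subset n → SetVector {n} → Set ℓ₂
  NonNegOff T w = ∀ S → S ≢ T → 0# ≤ w S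

  Null : ∀ {n} → SetVector {n} → Set ℓ₁
  Null w = ∀ S → w S ≈ 0#

  null? : ∀ {n} (w : SetVector {n}) → Null w ⊎ (∃[ S ] ¬ (w S ≈ 0#))
  null? w with anySubset? (λ S → ¬? (w S ≟ 0#))
  ... | yes found = inj₂ found
  ... | no  none  = inj₁ (λ S → decidable-stable (w S ≟ 0#) (λ wS≉0 → none (S , wS≉0)))

  ⟨⟩-null : ∀ {n} {w : SetVector {n}} m → Null w → ⟨ w , m ⟩ ≈ 0#
  ⟨⟩-null {n} m w≈0 = trans (Σ⊆-cong (λ S → trans (*-congʳ (w≈0 S)) (zeroˡ (m S)))) (Σ⊆-zero n)

  Balanced-linear : ∀ {n} {w v : SetVector {n}} {r q} t → Balanced w r → Balanced v q →
                    Balanced (λ S → w S + t * v S) (r + t * q)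
  Balanced-linear {w = w} {v} t W V = record
    { at-∅     = trans (+-cong W.at-∅ (trans (*-congˡ V.at-∅) (zeroʳ t))) (+-identityʳ 0#)
    ; at-N     = trans (+-cong W.at-N (trans (*-congˡ V.at-N) (zeroʳ t))) (+-identityʳ 0#)
    ; constant = λ i → trans (⟨⟩-linear w v t (λ S → χ S i)) (+-cong (W.constant i) (*-congˡ (V.constant i)))
    }
    where
    module W = Balanced W
    module V = Balanced V

  Balanced-scale : ∀ {n} {w : SetVector {n}} {r} t → Balanced w r → Balanced (λ S → t * w S) (t * r)
  Balanced-scale {w = w} t W = record
    { at-∅     = trans (*-congˡ at-∅) (zeroʳ t)
    ; at-N     = trans (*-congˡ at-N) (zeroʳ t)
    ; constant = λ i → trans (⟨⟩-scale w t (λ S → χ S i)) (*-congˡ (constant i))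
    }
    where open Balanced W

  nonNeg-everywhere : ∀ {n} {T : Subset n} {w} → NonNegOff T w → 0# ≤ w T → ∀ S → 0# ≤ w S
  nonNeg-everywhere {T = T} 0≤w 0≤wT S with S ≟ˢ T
  ... | yes ≡.refl = 0≤wT
  ... | no S≢T     = 0≤w S S≢T

  module _ {n} {w : SetVector {n}} {r} {T : Subset n} (W : Balanced w r) (0≤w : NonNegOff T w) where
    open Balanced W

    private
      -- These split the total of w at a player: `outer j` sums to r and `inner i` to the total
      -- minus r. For j outside `T` and i inside `T` the possibly negative term at `T` drops out,
      -- leaving sums of non-negative terms.
      outer inner : Fin n → Subset n → Carrier
      outer j S = w S * χ S j
      inner i S = w S * (1# - χ S i)

      Σ-inner : ∀ i → Σ⊆ (inner i) ≈ Σ⊆ w - r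
      Σ-inner i = begin-equality
        Σ⊆ (inner i)
          ≈⟨ Σ⊆-cong (λ S → solve 2 (λ w x → w :* (con (+ 1) :- x) := w :+ (:- con (+ 1)) :* (w :* x)) refl (w S) (χ S i)) ⟩
        Σ⊆ (λ S → w S + - 1# * (w S * χ S i))
          ≈⟨ Σ⊆-linear w (λ S → w S * χ S i) (- 1#) ⟩
        Σ⊆ w + - 1# * ⟨ w , (λ S → χ S i) ⟩
          ≈⟨ +-congˡ (*-congˡ (constant i)) ⟩
        Σ⊆ w + - 1# * r
          ≈⟨ solve 2 (λ s r → s :+ (:- con (+ 1)) :* r := s :- r) refl (Σ⊆ w) r ⟩
        Σ⊆ w - r ∎

      outer-nonNeg : ∀ j → lookup T j ≡ false → ∀ S → 0# ≤ outer j S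
      outer-nonNeg j j∉T S with S ≟ˢ T
      ... | yes ≡.refl = ≤-reflexive (sym (trans (*-congˡ (reflexive (χ-outside S j j∉T))) (zeroʳ (w S))))
      ... | no S≢T     = *-nonNeg (0≤w S S≢T) (indicator-nonNeg (lookup S j))

      inner-nonNeg : ∀ i → lookup T i ≡ true → ∀ S → 0# ≤ inner i S
      inner-nonNeg i i∈T S with S ≟ˢ T
      ... | yes ≡.refl = ≤-reflexive (sym (trans
        (*-congˡ (trans (+-congˡ (-‿cong (reflexive (χ-inside S i i∈T)))) (-‿inverseʳ 1#))) (zeroʳ (w S))))
      ... | no S≢T     = *-nonNeg (0≤w S S≢T) (1-indicator-nonNeg (lookup S i))

    -- If w T < 0, evaluating the combination at j ∉ T and at i ∈ T gives
    -- 0 ≤ r ≤ Σ w; when Σ w ≤ 0 both bounds are tight, so that a set other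
    -- than T with positive weight contains no j ∉ T and every i ∈ T.
    nonPos-total⇒null : Σ⊆ w ≤ 0# → Null w
    nonPos-total⇒null Σw≤0 with 0# ≤? w T
    ... | yes 0≤wT = Σ⊆-nonNeg≤0⇒zero (nonNeg-everywhere 0≤w 0≤wT) Σw≤0
    ... | no  0≰wT = λ S → everywhere S (S ≟ˢ T)
      where
      -- Since w vanishes at ∅ and N, a set with negative weight is neither, and so has both a
      -- member and a non-member.
      T≢⊥ : T ≢ ⊥
      T≢⊥ ≡.refl = 0≰wT (≤-reflexive (sym at-∅))

      T≢⊤ : T ≢ ⊤
      T≢⊤ ≡.refl = 0≰wT (≤-reflexive (sym at-N))

      member : ∃[ i ] lookup T i ≡ true
      member with differ T≢⊥
      ... | i , Tᵢ≢⊥ᵢ = i , Boolₚ.¬-not (λ eq → Tᵢ≢⊥ᵢ (≡.trans eq (≡.sym (Vecₚ.lookup-replicate i outside))))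

      non-member : ∃[ j ] lookup T j ≡ false
      non-member with differ T≢⊤
      ... | j , Tⱼ≢⊤ⱼ = j , Boolₚ.¬-not (λ eq → Tⱼ≢⊤ⱼ (≡.trans eq (≡.sym (Vecₚ.lookup-replicate j inside))))

      0≤r : 0# ≤ r
      0≤r = ≤-trans (Σ⊆-nonNeg (outer-nonNeg (proj₁ non-member) (proj₂ non-member)))
              (≤-reflexive (constant (proj₁ non-member)))

      r≤Σw : r ≤ Σ⊆ w
      r≤Σw = 0≤y-x⇒x≤y (≤-trans (Σ⊆-nonNeg (inner-nonNeg (proj₁ member) (proj₂ member)))
               (≤-reflexive (Σ-inner (proj₁ member))))

      outer-null : ∀ j → lookup T j ≡ false → ∀ S → outer j S ≈ 0#
      outer-null j j∉T = Σ⊆-nonNeg≤0⇒zero (outer-nonNeg j j∉T)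
        (≤-trans (≤-reflexive (constant j)) (≤-trans r≤Σw Σw≤0))

      inner-null : ∀ i → lookup T i ≡ true → ∀ S → inner i S ≈ 0#
      inner-null i i∈T = Σ⊆-nonNeg≤0⇒zero (inner-nonNeg i i∈T) (begin
        Σ⊆ (inner i)   ≈⟨ Σ-inner i ⟩
        Σ⊆ w - r       ≤⟨ +-mono-≤ Σw≤0 (neg-nonNeg 0≤r) ⟩
        0# + 0#        ≈⟨ +-identityʳ 0# ⟩
        0#             ∎)

      off-T : ∀ S → S ≢ T → w S ≈ 0#
      off-T S S≢T with differ S≢T
      ... | k , Sₖ≢Tₖ with lookup T k in Tₖ | lookup S k in Sₖ
      ...   | false | false = contradiction ≡.refl Sₖ≢Tₖ
      ...   | true  | true  = contradiction ≡.refl Sₖ≢Tₖ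
      ...   | false | true  = begin-equality
        w S           ≈⟨ *-identityʳ (w S) ⟨
        w S * 1#      ≡⟨ ≡.cong (w S *_) (χ-inside S k Sₖ) ⟨
        outer k S     ≈⟨ outer-null k Tₖ S ⟩
        0#            ∎
      ...   | true  | false = begin-equality
        w S              ≈⟨ solve 1 (λ w → w := w :* (con (+ 1) :- con (+ 0))) refl (w S) ⟩
        w S * (1# - 0#)  ≡⟨ ≡.cong (λ x → w S * (1# - x)) (χ-outside S k Sₖ) ⟨
        inner k S        ≈⟨ inner-null k Tₖ S ⟩
        0#               ∎

      -- With w zero off `T` and negative at `T`, the vector - w is non-negative; as 0 ≤ r ≤ Σ w,
      -- its total is at most 0, which forces w to vanish at `T` too.
      neg-w-nonNeg : ∀ S → 0# ≤ - 1# * w S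
      neg-w-nonNeg = nonNeg-everywhere
        (λ S S≢T → ≤-reflexive (sym (trans (*-congˡ (off-T S S≢T)) (zeroʳ (- 1#)))))
        (≤-trans (neg-nonPos (≰⇒≥ 0≰wT)) (≤-reflexive (solve 1 (λ x → :- x := (:- con (+ 1)) :* x) refl (w T))))

      at-T : w T ≈ 0#
      at-T = begin-equality
        w T                    ≈⟨ solve 1 (λ x → x := (:- con (+ 1)) :* ((:- con (+ 1)) :* x)) refl (w T) ⟩
        - 1# * (- 1# * w T)    ≈⟨ *-congˡ (Σ⊆-nonNeg≤0⇒zero neg-w-nonNeg Σ-neg≤0 T) ⟩
        - 1# * 0#              ≈⟨ zeroʳ (- 1#) ⟩
        0#                     ∎
        where
        Σ-neg≤0 : Σ⊆ (λ S → - 1# * w S) ≤ 0#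
        Σ-neg≤0 = begin
          Σ⊆ (λ S → - 1# * w S)   ≈⟨ Σ⊆-scale w (- 1#) ⟩
          - 1# * Σ⊆ w             ≈⟨ solve 1 (λ x → (:- con (+ 1)) :* x := :- x) refl (Σ⊆ w) ⟩
          - Σ⊆ w                  ≤⟨ neg-nonNeg (≤-trans 0≤r r≤Σw) ⟩
          0#                      ∎

      everywhere : ∀ S → Dec (S ≡ T) → w S ≈ 0#
      everywhere S (yes ≡.refl) = at-T
      everywhere S (no S≢T)     = off-T S S≢T

  -- If no set other than T had positive weight, - w would be semi-conic as
  -- well, while w and - w cannot both have a positive total.
  positive-off : ∀ {n} {w : SetVector {n}} {r T′} → Balanced w r → NonNegOff T′ w → ∃[ S ] ¬ (w S ≈ 0#) →
                 ∀ T → ∃[ S ] S ≢ T × ¬ (w S ≤ 0#)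
  positive-off {w = w} W 0≤w (U , wU≉0) T with anySubset? (λ S → ¬? (S ≟ˢ T) ×-dec ¬? (w S ≤? 0#))
  ... | yes found = found
  ... | no  none  = contradiction (null (total (Σ⊆ w) 0#) U) wU≉0
    where
    -w-nonNegOff : NonNegOff T (λ S → - 1# * w S)
    -w-nonNegOff S S≢T = ≤-trans (neg-nonPos (decidable-stable (w S ≤? 0#) (λ wS≰0 → none (S , S≢T , wS≰0))))
      (≤-reflexive (solve 1 (λ x → :- x := (:- con (+ 1)) :* x) refl (w S)))

    null : (Σ⊆ w ≤ 0#) ⊎ (0# ≤ Σ⊆ w) → Null w
    null (inj₁ Σw≤0) = nonPos-total⇒null W 0≤w Σw≤0
    null (inj₂ 0≤Σw) S = begin-equality
      w S                    ≈⟨ solve 1 (λ x → x := (:- con (+ 1)) :* ((:- con (+ 1)) :* x)) refl (w S) ⟩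
      - 1# * (- 1# * w S)    ≈⟨ *-congˡ (nonPos-total⇒null (Balanced-scale (- 1#) W) -w-nonNegOff Σ-neg≤0 S) ⟩
      - 1# * 0#              ≈⟨ zeroʳ (- 1#) ⟩
      0#                     ∎
      where
      Σ-neg≤0 : Σ⊆ (λ S → - 1# * w S) ≤ 0#
      Σ-neg≤0 = begin
        Σ⊆ (λ S → - 1# * w S)   ≈⟨ Σ⊆-scale w (- 1#) ⟩
        - 1# * Σ⊆ w             ≈⟨ solve 1 (λ x → (:- con (+ 1)) :* x := :- x) refl (Σ⊆ w) ⟩
        - Σ⊆ w                  ≤⟨ neg-nonNeg 0≤Σw ⟩
        0#                      ∎

  -- The set `S₀` lies in the support of v but not in that of the difference; this is how supports
  -- shrink strictly.
  record Pivot {n} (T : Subset n) (w v : SetVector {n}) : Set (c ⊔ ℓ₁ ⊔ ℓ₂) where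
    field
      t        : Carrier
      0≤t      : 0# ≤ t
      S₀       : Subset n
      v≉0      : ¬ (v S₀ ≈ 0#)
      vanishes : w S₀ + - t * v S₀ ≈ 0#
      nonNeg   : NonNegOff T (λ S → w S + - t * v S)

  -- The ratio test of the simplex method: t is the least `w S / v S` over the sets S other than `T`
  -- with `v S` positive. Where `v S` is not positive, subtracting t v cannot lower the coefficient,
  -- so nothing is asked about the signs of v.
  pivot : ∀ {n} {T : Subset n} {w v : SetVector {n}} → NonNegOff T w →
          ∃[ S ] S ≢ T × ¬ (v S ≤ 0#) → Pivot T w v
  pivot {n} {T} {w} {v} 0≤w (S₁ , S₁≢T , vS₁≰0) = record
    { t        = ratio S₀
    ; 0≤t      = *-nonNeg (0≤w S₀ S₀≢T) (⁻¹-nonNeg (≰⇒≥ vS₀≰0))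
    ; S₀       = S₀
    ; v≉0      = vS₀≰0 ∘ ≤-reflexive
    ; vanishes = begin-equality
        w S₀ + - ratio S₀ * v S₀   ≈⟨ solve 3 (λ w t v → w :+ (:- t) :* v := w :- t :* v) refl (w S₀) (ratio S₀) (v S₀) ⟩
        w S₀ - ratio S₀ * v S₀     ≈⟨ +-congˡ (-‿cong (ratio-* vS₀≰0)) ⟩
        w S₀ - w S₀                ≈⟨ -‿inverseʳ (w S₀) ⟩
        0#                         ∎
    ; nonNeg   = λ S S≢T → ≤-trans (x≤y⇒0≤y-x (t*v≤w S S≢T))
        (≤-reflexive (solve 3 (λ w t v → w :- t :* v := w :+ (:- t) :* v) refl (w S) (ratio S₀) (v S)))
    }
    where
    open Extrema totalOrder using (argmin; argmin-all; f[argmin]≤f[xs])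

    ratio : Subset n → Carrier
    ratio S = w S * v S ⁻¹

    ratio-* : ∀ {S} → ¬ (v S ≤ 0#) → ratio S * v S ≈ w S
    ratio-* {S} vS≰0 = begin-equality
      (w S * v S ⁻¹) * v S   ≈⟨ solve 3 (λ w u v → (w :* u) :* v := w :* (v :* u)) refl (w S) (v S ⁻¹) (v S) ⟩
      w S * (v S * v S ⁻¹)   ≈⟨ *-congˡ (*-inverseʳ (vS≰0 ∘ ≤-reflexive)) ⟩
      w S * 1#               ≈⟨ *-identityʳ (w S) ⟩
      w S                    ∎

    Candidate : Subset n → Set ℓ₂
    Candidate S = S ≢ T × ¬ (v S ≤ 0#)

    candidate? : ∀ S → Dec (Candidate S)
    candidate? S = ¬? (S ≟ˢ T) ×-dec ¬? (v S ≤? 0#)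

    candidates : List (Subset n)
    candidates = filter candidate? (subsets n)

    S₀ : Subset n
    S₀ = argmin ratio S₁ candidates

    S₀-candidate : Candidate S₀
    S₀-candidate = argmin-all ratio {S₁} {candidates} {P = Candidate}
      (S₁≢T , vS₁≰0) (Allₚ.all-filter candidate? (subsets n))

    S₀≢T : S₀ ≢ T
    S₀≢T = proj₁ S₀-candidate

    vS₀≰0 : ¬ (v S₀ ≤ 0#)
    vS₀≰0 = proj₂ S₀-candidate

    t*v≤w : ∀ S → S ≢ T → ratio S₀ * v S ≤ w S
    t*v≤w S S≢T with v S ≤? 0#
    ... | yes vS≤0 = begin
      ratio S₀ * v S   ≤⟨ *-monoˡ-≤ (*-nonNeg (0≤w S₀ S₀≢T) (⁻¹-nonNeg (≰⇒≥ vS₀≰0))) vS≤0 ⟩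
      ratio S₀ * 0#    ≈⟨ zeroʳ (ratio S₀) ⟩
      0#               ≤⟨ 0≤w S S≢T ⟩
      w S              ∎
    ... | no vS≰0  = begin
      ratio S₀ * v S   ≈⟨ *-comm (ratio S₀) (v S) ⟩
      v S * ratio S₀   ≤⟨ *-monoˡ-≤ (≰⇒≥ vS≰0)
                            (All.lookup (f[argmin]≤f[xs] {f = ratio} S₁ candidates)
                              (∈-filter⁺ candidate? (∈-subsets S) (S≢T , vS≰0))) ⟩
      v S * ratio S    ≈⟨ *-comm (v S) (ratio S) ⟩
      ratio S * v S    ≈⟨ ratio-* vS≰0 ⟩
      w S              ∎

-- Set systems and their θ-vectors in terms of balanced weights.

module Characterisation {c ℓ₁ ℓ₂ : Level} (ℝ : Reals c ℓ₁ ℓ₂) (k : ℕ) where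

  open Reals ℝ hiding (zero; Carrier; _≤_; 0#)
  open Games ℝ renaming (_⟨_⟩ to payoff)
  open OrderedField ℝ
  open FourierMotzkin ℝ
  open SemiConicCombinations ℝ

  -- Having a player `zero` lets the constant r be read off from w, as in `null⇒constant≈0`.
  n : ℕ
  n = suc k

  -- Coefficients in `SemiBalanced` and `Θ` are arbitrary off the system; zeroing them there yields
  -- a weight to which `Balanced` applies.
  restrict : SetSystem n → SetVector {n} → SetVector {n}
  restrict 𝒮 w S = if 𝒮 S then w S else 0#

  restrict-∈ : ∀ 𝒮 w {S} → S ∈ˢ 𝒮 → restrict 𝒮 w S ≡ w S
  restrict-∈ 𝒮 w {S} S∈𝒮 with 𝒮 S
  ... | true = ≡.refl

  restrict-∉ : ∀ 𝒮 w {S} → S ∉ˢ 𝒮 → restrict 𝒮 w S ≡ 0#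
  restrict-∉ 𝒮 w {S} S∉𝒮 with 𝒮 S
  ... | true  = contradiction _ S∉𝒮
  ... | false = ≡.refl

  restrict-* : ∀ 𝒮 w (f : SetVector {n}) → ⟨ restrict 𝒮 w , f ⟩ ≈ Σ[ 𝒮 ] (λ S → w S * f S)
  restrict-* 𝒮 w f = Σ⊆-cong pointwise
    where
    pointwise : ∀ S → restrict 𝒮 w S * f S ≈ restrict 𝒮 (λ S → w S * f S) S
    pointwise S with 𝒮 S
    ... | true  = refl
    ... | false = zeroˡ (f S)

  Σ[]-supported : ∀ 𝒮 (f : SetVector {n}) → (∀ S → S ∉ˢ 𝒮 → f S ≈ 0#) → Σ[ 𝒮 ] f ≈ Σ⊆ f
  Σ[]-supported 𝒮 f f≈0 = Σ⊆-cong pointwise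
    where
    pointwise : ∀ S → restrict 𝒮 f S ≈ f S
    pointwise S with T? (𝒮 S)
    ... | yes S∈𝒮 = reflexive (restrict-∈ 𝒮 f S∈𝒮)
    ... | no  S∉𝒮 = trans (reflexive (restrict-∉ 𝒮 f S∉𝒮)) (sym (f≈0 S S∉𝒮))

  restrict-Balanced : ∀ {𝒮 w r} → NonTrivial 𝒮 → YieldsConstant 𝒮 w r → Balanced (restrict 𝒮 w) r
  restrict-Balanced {𝒮} {w} (_ , ⊥∉𝒮 , ⊤∉𝒮) yields = record
    { at-∅     = reflexive (restrict-∉ 𝒮 w ⊥∉𝒮)
    ; at-N     = reflexive (restrict-∉ 𝒮 w ⊤∉𝒮)
    ; constant = λ i → trans (restrict-* 𝒮 w (λ S → χ S i)) (yields i)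
    }

  restrict-NonNegOff : ∀ {𝒮 w} → SemiConic 𝒮 w → ∃[ U ] NonNegOff U (restrict 𝒮 w)
  restrict-NonNegOff {𝒮} {w} conic with anySubset? (λ S → T? (𝒮 S) ×-dec ¬? (0# ≤? w S))
  -- Without negative coefficients any exceptional set would do; ∅ is picked.
  ... | no none = ⊥ , λ S _ → nonNeg S
    where
    nonNeg : ∀ S → 0# ≤ restrict 𝒮 w S
    nonNeg S with T? (𝒮 S)
    ... | no S∉𝒮  = ≤-reflexive (reflexive (≡.sym (restrict-∉ 𝒮 w S∉𝒮)))
    ... | yes S∈𝒮 = ≤-trans (decidable-stable (0# ≤? w S) (λ 0≰wS → none (S , S∈𝒮 , 0≰wS)))
                      (≤-reflexive (reflexive (≡.sym (restrict-∈ 𝒮 w S∈𝒮))))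
  ... | yes (U , U∈𝒮 , 0≰wU) = U , nonNeg
    where
    negative : ∀ {S} → ¬ (0# ≤ w S) → w S < 0#
    negative 0≰wS = ≰⇒≥ 0≰wS , λ wS≈0 → 0≰wS (≤-reflexive (sym wS≈0))

    nonNeg : NonNegOff U (restrict 𝒮 w)
    nonNeg S S≢U with T? (𝒮 S)
    ... | no S∉𝒮  = ≤-reflexive (reflexive (≡.sym (restrict-∉ 𝒮 w S∉𝒮)))
    ... | yes S∈𝒮 = ≤-trans (decidable-stable (0# ≤? w S)
                        (λ 0≰wS → S≢U (conic S U S∈𝒮 U∈𝒮 (negative 0≰wS) (negative 0≰wU))))
                      (≤-reflexive (reflexive (≡.sym (restrict-∈ 𝒮 w S∈𝒮))))

  NonNegOff⇒SemiConic : ∀ {𝒮 : SetSystem n} {U w} → NonNegOff U w → SemiConic 𝒮 w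
  NonNegOff⇒SemiConic {U = U} {w} 0≤w S S′ _ _ wS<0 wS′<0 = ≡.trans (at-U S wS<0) (≡.sym (at-U S′ wS′<0))
    where
    at-U : ∀ S → w S < 0# → S ≡ U
    at-U S (wS≤0 , wS≉0) = decidable-stable (S ≟ˢ U) (λ S≢U → wS≉0 (antisym wS≤0 (0≤w S S≢U)))

  support : SetVector {n} → SetSystem n
  support w S = not (does (w S ≟ 0#))

  ∈-support⁺ : ∀ {w S} → ¬ (w S ≈ 0#) → S ∈ˢ support w
  ∈-support⁺ {w} {S} wS≉0 with w S ≟ 0#
  ... | yes wS≈0 = contradiction wS≈0 wS≉0
  ... | no  _    = _

  ∈-support⁻ : ∀ {w S} → S ∈ˢ support w → ¬ (w S ≈ 0#)
  ∈-support⁻ {w} {S} S∈ with w S ≟ 0#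
  ... | no wS≉0 = wS≉0

  ∉-support⁻ : ∀ {w S} → S ∉ˢ support w → w S ≈ 0#
  ∉-support⁻ {w} {S} S∉ = decidable-stable (w S ≟ 0#) (S∉ ∘ ∈-support⁺ {w})

  support-⊆ : ∀ {w 𝒮} → (∀ S → S ∉ˢ 𝒮 → w S ≈ 0#) → ∀ S → S ∈ˢ support w → S ∈ˢ 𝒮
  support-⊆ {w} {𝒮} w≈0 S S∈ = decidable-stable (T? (𝒮 S)) (λ S∉𝒮 → ∈-support⁻ {w} S∈ (w≈0 S S∉𝒮))

  supported-YieldsConstant : ∀ {𝒮 w r} → (∀ S → S ∉ˢ 𝒮 → w S ≈ 0#) → Balanced w r → YieldsConstant 𝒮 w r
  supported-YieldsConstant {𝒮} {w} w≈0 W i = trans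
    (Σ[]-supported 𝒮 (λ S → w S * χ S i) (λ S S∉𝒮 → trans (*-congʳ (w≈0 S S∉𝒮)) (zeroˡ (χ S i)))) (Balanced.constant W i)

  support-SemiBalanced : ∀ {U w r} → Balanced w r → NonNegOff U w → ∃[ S ] ¬ (w S ≈ 0#) → SemiBalanced (support w)
  support-SemiBalanced {w = w} {r} W 0≤w (S , wS≉0) =
    ((S , ∈-support⁺ {w} wS≉0) , (λ ⊥∈ → ∈-support⁻ {w} ⊥∈ (Balanced.at-∅ W)) ,
      (λ ⊤∈ → ∈-support⁻ {w} ⊤∈ (Balanced.at-N W))) ,
    r , w , NonNegOff⇒SemiConic {support w} 0≤w , (λ S → ∈-support⁻ {w}) ,
    supported-YieldsConstant {support w} (λ S → ∉-support⁻ {w}) W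

  -- θ as a linear combination of w and two point masses, so that its pairing with m follows by
  -- linearity. The masses do not interfere with w, which is zero at ∅ and N when balanced.
  assign : SetVector {n} → Carrier → SetVector {n}
  assign w r S = - w S + (r * δ ⊤ S + (1# - r) * δ ⊥ S)

  -- The term at ∅ disappears because m(∅) = 0. What remains is homogeneous in w and r jointly, so
  -- the scaling to total 1 can be undone.
  assign-⟨⟩ : ∀ w r m → IsGame m → ⟨ assign w r , m ⟩ ≈ r * m ⊤ - ⟨ w , m ⟩
  assign-⟨⟩ w r m m⊥≈0 = begin-equality
    ⟨ assign w r , m ⟩
      ≈⟨ ⟨⟩-congˡ m (λ S → solve 4 (λ w r x y → (:- w) :+ (r :* x :+ (con (+ 1) :- r) :* y)
           := ((:- con (+ 1)) :* w :+ r :* x) :+ (con (+ 1) :- r) :* y) refl (w S) r (δ ⊤ S) (δ ⊥ S)) ⟩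
    ⟨ (λ S → (- 1# * w S + r * δ ⊤ S) + (1# - r) * δ ⊥ S) , m ⟩
      ≈⟨ ⟨⟩-linear (λ S → - 1# * w S + r * δ ⊤ S) (δ ⊥) (1# - r) m ⟩
    ⟨ (λ S → - 1# * w S + r * δ ⊤ S) , m ⟩ + (1# - r) * ⟨ δ ⊥ , m ⟩
      ≈⟨ +-cong (⟨⟩-linear (λ S → - 1# * w S) (δ ⊤) r m) (*-congˡ (trans (Σ⊆-δ ⊥ m) m⊥≈0)) ⟩
    (⟨ (λ S → - 1# * w S) , m ⟩ + r * ⟨ δ ⊤ , m ⟩) + (1# - r) * 0#
      ≈⟨ +-congʳ (+-cong (⟨⟩-scale w (- 1#) m) (*-congˡ (Σ⊆-δ ⊤ m))) ⟩
    (- 1# * ⟨ w , m ⟩ + r * m ⊤) + (1# - r) * 0#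
      ≈⟨ solve 3 (λ x r y → ((:- con (+ 1)) :* x :+ r :* y) :+ (con (+ 1) :- r) :* con (+ 0) := r :* y :- x) refl
           ⟨ w , m ⟩ r (m ⊤) ⟩
    r * m ⊤ - ⟨ w , m ⟩ ∎

  assign-cong : ∀ {w w′ r r′} → w ≋ w′ → r ≈ r′ → assign w r ≋ assign w′ r′
  assign-cong w≋w′ r≈r′ S =
    +-cong (-‿cong (w≋w′ S)) (+-cong (*-congʳ r≈r′) (*-congʳ (+-congˡ (-‿cong r≈r′))))

  assign-⊤ : ∀ w r → w ⊤ ≈ 0# → assign w r ⊤ ≈ r
  assign-⊤ w r w⊤≈0 = begin-equality
    - w ⊤ + (r * δ {n} ⊤ ⊤ + (1# - r) * 0#)
      ≈⟨ +-cong (-‿cong w⊤≈0) (+-congʳ (*-congˡ (reflexive (δ-refl {n} ⊤)))) ⟩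
    - 0# + (r * 1# + (1# - r) * 0#)
      ≈⟨ solve 1 (λ r → (:- con (+ 0)) :+ (r :* con (+ 1) :+ (con (+ 1) :- r) :* con (+ 0)) := r) refl r ⟩
    r ∎

  assign-⊥ : ∀ w r → w ⊥ ≈ 0# → assign w r ⊥ ≈ 1# - r
  assign-⊥ w r w⊥≈0 = begin-equality
    - w ⊥ + (r * 0# + (1# - r) * δ {n} ⊥ ⊥)
      ≈⟨ +-cong (-‿cong w⊥≈0) (+-congˡ (*-congˡ (reflexive (δ-refl {n} ⊥)))) ⟩
    - 0# + (r * 0# + (1# - r) * 1#)
      ≈⟨ solve 1 (λ r → (:- con (+ 0)) :+ (r :* con (+ 0) :+ (con (+ 1) :- r) :* con (+ 1)) := con (+ 1) :- r) refl r ⟩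
    1# - r ∎

  assign-elsewhere : ∀ w r {S} → S ≢ ⊤ → S ≢ ⊥ → assign w r S ≈ - w S
  assign-elsewhere w r {S} S≢⊤ S≢⊥ = begin-equality
    - w S + (r * δ ⊤ S + (1# - r) * δ ⊥ S)
      ≈⟨ +-congˡ (+-cong (*-congˡ (reflexive (δ-≢ (S≢⊤ ∘ ≡.sym)))) (*-congˡ (reflexive (δ-≢ (S≢⊥ ∘ ≡.sym))))) ⟩
    - w S + (r * 0# + (1# - r) * 0#)
      ≈⟨ solve 2 (λ x r → x :+ (r :* con (+ 0) :+ (con (+ 1) :- r) :* con (+ 0)) := x) refl (- w S) r ⟩
    - w S ∎

  Θ-assign : ∀ {𝒮 w r U} → NonTrivial 𝒮 → (∀ S → S ∉ˢ 𝒮 → w S ≈ 0#) →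
             Balanced w r → NonNegOff U w → Σ⊆ w ≈ 1# → Θ 𝒮 (assign w r)
  Θ-assign {𝒮} {w} {r} (_ , ⊥∉𝒮 , ⊤∉𝒮) w≈0 W 0≤w Σw≈1 =
    w , r , trans (Σ[]-supported 𝒮 w w≈0) Σw≈1 , NonNegOff⇒SemiConic {𝒮} 0≤w ,
    supported-YieldsConstant {𝒮} w≈0 W , record
      { on-𝒮      = λ S S∈𝒮 → assign-elsewhere w r (λ { ≡.refl → ⊤∉𝒮 S∈𝒮 }) (λ { ≡.refl → ⊥∉𝒮 S∈𝒮 })
      ; on-N      = assign-⊤ w r at-N
      ; on-∅      = assign-⊥ w r at-∅
      ; elsewhere = λ S S∉𝒮 S≢⊤ S≢⊥ → trans (assign-elsewhere w r S≢⊤ S≢⊥) (trans (-‿cong (w≈0 S S∉𝒮)) -0#≈0#)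
      }
    where open Balanced W

  -- Non-triviality makes the cases of `Assigned` disjoint and exhaustive. Uniqueness of θ thereby
  -- reduces to uniqueness of the restricted weight and of r.
  Assigned⇒≋ : ∀ {𝒮 w r θ} → NonTrivial 𝒮 → Assigned 𝒮 w r θ → θ ≋ assign (restrict 𝒮 w) r
  Assigned⇒≋ {𝒮} {w} {r} {θ} (_ , ⊥∉𝒮 , ⊤∉𝒮) assigned S with S ≟ˢ ⊤ | S ≟ˢ ⊥
  ... | yes ≡.refl | _          = trans on-N (sym (assign-⊤ (restrict 𝒮 w) r (reflexive (restrict-∉ 𝒮 w ⊤∉𝒮))))
    where open Assigned assigned
  ... | no _       | yes ≡.refl = trans on-∅ (sym (assign-⊥ (restrict 𝒮 w) r (reflexive (restrict-∉ 𝒮 w ⊥∉𝒮))))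
    where open Assigned assigned
  ... | no S≢⊤     | no S≢⊥     = trans value (sym (assign-elsewhere (restrict 𝒮 w) r S≢⊤ S≢⊥))
    where
    open Assigned assigned
    value : θ S ≈ - restrict 𝒮 w S
    value with T? (𝒮 S)
    ... | yes S∈𝒮 = trans (on-𝒮 S S∈𝒮) (-‿cong (reflexive (≡.sym (restrict-∈ 𝒮 w S∈𝒮))))
    ... | no  S∉𝒮 = trans (elsewhere S S∉𝒮 S≢⊤ S≢⊥)
                      (trans (sym -0#≈0#) (-‿cong (reflexive (≡.sym (restrict-∉ 𝒮 w S∉𝒮)))))

  null⇒constant≈0 : ∀ {w : SetVector {n}} {r} → Null w → Balanced w r → r ≈ 0#
  null⇒constant≈0 w≈0 W = trans (sym (Balanced.constant W zero)) (⟨⟩-null (λ S → χ S zero) w≈0)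

  record Normalisation (w : SetVector {n}) (r : Carrier) (U : Subset n) : Set (c ⊔ ℓ₁ ⊔ ℓ₂) where
    field
      total u  : Carrier
      0≤total  : 0# ≤ total
      total*u  : total * u ≈ 1#
      balanced : Balanced (λ S → u * w S) (u * r)
      nonNeg   : NonNegOff U (λ S → u * w S)
      affine   : Σ⊆ (λ S → u * w S) ≈ 1#

  normalisation : ∀ {w r U} → Balanced w r → NonNegOff U w → ∃[ S ] ¬ (w S ≈ 0#) → Normalisation w r U
  normalisation {w} {r} {U} W 0≤w (S , wS≉0) = record
    { total    = s
    ; u        = s ⁻¹
    ; 0≤total  = 0≤s
    ; total*u  = *-inverseʳ s≉0
    ; balanced = Balanced-scale (s ⁻¹) W
    ; nonNeg   = λ S S≢U → *-nonNeg (⁻¹-nonNeg 0≤s) (0≤w S S≢U)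
    ; affine   = trans (Σ⊆-scale w (s ⁻¹)) (trans (*-comm (s ⁻¹) s) (*-inverseʳ s≉0))
    }
    where
    s : Carrier
    s = Σ⊆ w

    s≰0 : ¬ (s ≤ 0#)
    s≰0 s≤0 = wS≉0 (nonPos-total⇒null W 0≤w s≤0 S)

    0≤s : 0# ≤ s
    0≤s = ≰⇒≥ s≰0

    s≉0 : ¬ (s ≈ 0#)
    s≉0 = s≰0 ∘ ≤-reflexive

  -- The homogeneous inequalities and the reduction to minimal systems.

  module _ (m : SetVector {n}) (m⊥≈0 : IsGame m) where

    Dominated : SetVector {n} → Carrier → Set ℓ₂
    Dominated w r = ⟨ w , m ⟩ ≤ r * m ⊤

    -- The homogeneous form of conditions (ii) and (iii).
    AllDominated : Set (c ⊔ ℓ₁ ⊔ ℓ₂)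
    AllDominated = ∀ w r {U} → Balanced w r → NonNegOff U w → Dominated w r

    NonNegOnSemiBalanced NonNegOnMinSemiBalanced : Set (c ⊔ ℓ₁ ⊔ ℓ₂)
    NonNegOnSemiBalanced    = ∀ (𝒮 : SetSystem n) → SemiBalanced 𝒮 → ∀ θ → Θ 𝒮 θ → 0# ≤ ⟨ θ , m ⟩
    NonNegOnMinSemiBalanced = ∀ (𝒮 : SetSystem n) → MinSemiBalanced 𝒮 → Forθ 𝒮 (λ θ → 0# ≤ ⟨ θ , m ⟩)

    null⇒Dominated : ∀ {w r} → Null w → Balanced w r → Dominated w r
    null⇒Dominated {w} {r} w≈0 W = ≤-reflexive (begin-equality
      ⟨ w , m ⟩   ≈⟨ ⟨⟩-null m w≈0 ⟩
      0#          ≈⟨ sym (zeroˡ (m ⊤)) ⟩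
      0# * m ⊤    ≈⟨ sym (*-congʳ (null⇒constant≈0 w≈0 W)) ⟩
      r * m ⊤     ∎)

    assign-nonNeg⇒Dominated : ∀ w r → 0# ≤ ⟨ assign w r , m ⟩ → Dominated w r
    assign-nonNeg⇒Dominated w r 0≤ = 0≤y-x⇒x≤y (≤-trans 0≤ (≤-reflexive (assign-⟨⟩ w r m m⊥≈0)))

    Dominated⇒assign-nonNeg : ∀ w r → Dominated w r → 0# ≤ ⟨ assign w r , m ⟩
    Dominated⇒assign-nonNeg w r dom = ≤-trans (x≤y⇒0≤y-x dom) (≤-reflexive (sym (assign-⟨⟩ w r m m⊥≈0)))

    unscale-Dominated : ∀ w r {t u} → 0# ≤ t → t * u ≈ 1# → Dominated (λ S → u * w S) (u * r) → Dominated w r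
    unscale-Dominated w r {t} {u} 0≤t tu≈1 dom = begin
      ⟨ w , m ⟩                        ≈⟨ sym (*-identityˡ ⟨ w , m ⟩) ⟩
      1# * ⟨ w , m ⟩                   ≈⟨ sym (*-congʳ tu≈1) ⟩
      (t * u) * ⟨ w , m ⟩              ≈⟨ *-assoc t u ⟨ w , m ⟩ ⟩
      t * (u * ⟨ w , m ⟩)              ≈⟨ sym (*-congˡ (⟨⟩-scale w u m)) ⟩
      t * ⟨ (λ S → u * w S) , m ⟩      ≤⟨ *-monoˡ-≤ 0≤t dom ⟩
      t * ((u * r) * m ⊤)              ≈⟨ solve 4 (λ t u r x → t :* ((u :* r) :* x) := (t :* u) :* (r :* x)) refl t u r (m ⊤) ⟩
      (t * u) * (r * m ⊤)              ≈⟨ *-congʳ tu≈1 ⟩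
      1# * (r * m ⊤)                   ≈⟨ *-identityˡ (r * m ⊤) ⟩
      r * m ⊤                          ∎

    scaled-support : ∀ (w : SetVector {n}) u S → S ∉ˢ support w → u * w S ≈ 0#
    scaled-support w u S S∉ = trans (*-congˡ (∉-support⁻ {w} S∉)) (zeroʳ u)

    AllDominated⇒NonNegOnSemiBalanced : AllDominated → NonNegOnSemiBalanced
    AllDominated⇒NonNegOnSemiBalanced dominated 𝒮 (nonTrivial , _) θ (w , r , _ , conic , yields , assigned) =
      ≤-trans (Dominated⇒assign-nonNeg (restrict 𝒮 w) r (dominated (restrict 𝒮 w) r
          (restrict-Balanced {𝒮} nonTrivial yields) (proj₂ (restrict-NonNegOff {𝒮} conic))))
        (≤-reflexive (sym (⟨⟩-congˡ m (Assigned⇒≋ nonTrivial assigned))))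

    NonNegOnSemiBalanced⇒AllDominated : NonNegOnSemiBalanced → AllDominated
    NonNegOnSemiBalanced⇒AllDominated hyp w r W 0≤w with null? w
    ... | inj₁ w≈0  = null⇒Dominated w≈0 W
    ... | inj₂ some = unscale-Dominated w r 0≤total total*u
          (assign-nonNeg⇒Dominated (λ S → u * w S) (u * r)
      (hyp (support w) sb (assign (λ S → u * w S) (u * r))
        (Θ-assign {support w} (proj₁ sb) (scaled-support w u) balanced nonNeg affine)))
      where
      open Normalisation (normalisation W 0≤w some)
      sb : SemiBalanced (support w)
      sb = support-SemiBalanced W 0≤w some

    private
      Dominated-combine : ∀ w v r q {t} → 0# ≤ t → Dominated v q →
                          Dominated (λ S → w S + - t * v S) (r + - t * q) → Dominated w r
      Dominated-combine w v r q {t} 0≤t dom-v dom = begin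
        ⟨ w , m ⟩
          ≈⟨ solve 3 (λ x t y → x := (x :+ (:- t) :* y) :+ t :* y) refl ⟨ w , m ⟩ t ⟨ v , m ⟩ ⟩
        (⟨ w , m ⟩ + - t * ⟨ v , m ⟩) + t * ⟨ v , m ⟩
          ≈⟨ sym (+-congʳ (⟨⟩-linear w v (- t) m)) ⟩
        ⟨ (λ S → w S + - t * v S) , m ⟩ + t * ⟨ v , m ⟩
          ≤⟨ +-mono-≤ dom (*-monoˡ-≤ 0≤t dom-v) ⟩
        (r + - t * q) * m ⊤ + t * (q * m ⊤)
          ≈⟨ solve 4 (λ r t q x → (r :+ (:- t) :* q) :* x :+ t :* (q :* x) := r :* x) refl r t q (m ⊤) ⟩
        r * m ⊤ ∎

    semiBalanced-weights : ∀ {𝒮} → SemiBalanced 𝒮 →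
      ∃[ w ] ∃[ r ] ∃[ U ] Balanced w r × NonNegOff U w × (∃[ S ] ¬ (w S ≈ 0#)) × (∀ S → S ∉ˢ 𝒮 → w S ≈ 0#)
    semiBalanced-weights {𝒮} (nonTrivial@((S , S∈𝒮) , _) , r , w , conic , w≉0 , yields) =
      restrict 𝒮 w , r , proj₁ off , restrict-Balanced {𝒮} nonTrivial yields , proj₂ off ,
      (S , λ eq → w≉0 S S∈𝒮 (trans (reflexive (≡.sym (restrict-∈ 𝒮 w S∈𝒮))) eq)) ,
      λ S′ S′∉𝒮 → reflexive (restrict-∉ 𝒮 w S′∉𝒮)
      where
      off : ∃[ U ] NonNegOff U (restrict 𝒮 w)
      off = restrict-NonNegOff {𝒮} conic

    -- Two affine combinations w and v over 𝒮: the pivot w - t v is semi-conic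
    -- with support strictly inside 𝒮, hence vanishes, and t = 1.
    MinSemiBalanced⇒unique : ∀ {𝒮 w r U v q U′} → MinSemiBalanced 𝒮 →
      (∀ S → S ∉ˢ 𝒮 → w S ≈ 0#) → (∀ S → S ∉ˢ 𝒮 → v S ≈ 0#) →
      Balanced w r → NonNegOff U w → Balanced v q → NonNegOff U′ v →
      Σ⊆ w ≈ 1# → Σ⊆ v ≈ 1# → w ≋ v × r ≈ q
    MinSemiBalanced⇒unique {𝒮} {w} {r} {U} {v} {q} (_ , minimal) w≈0 v≈0 W 0≤w V 0≤v Σw≈1 Σv≈1 =
      conclude (null? d)
      where
      v-some : ∃[ S ] ¬ (v S ≈ 0#)
      v-some with null? v
      ... | inj₂ some = some
      ... | inj₁ v≡0  = contradiction (trans (sym (Σ⊆-zero n)) (trans (sym (Σ⊆-cong v≡0)) Σv≈1)) 0≉1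

      -- The positive coefficient of v is needed off `U`, the exceptional set of w, whereas v is
      -- only known to be non-negative off its own exceptional set; `positive-off` allows for this.
      open Pivot (pivot {v = v} 0≤w (positive-off V 0≤v v-some U))

      d : SetVector {n}
      d S = w S + - t * v S

      D : Balanced d (r + - t * q)
      D = Balanced-linear (- t) W V

      d≈0 : ∀ S → S ∉ˢ 𝒮 → d S ≈ 0#
      d≈0 S S∉𝒮 = trans (+-cong (w≈0 S S∉𝒮) (trans (*-congˡ (v≈0 S S∉𝒮)) (zeroʳ (- t)))) (+-identityʳ 0#)

      S₀∈𝒮 : S₀ ∈ˢ 𝒮
      S₀∈𝒮 = decidable-stable (T? (𝒮 S₀)) (v≉0 ∘ v≈0 S₀)

      w-tv≈0⇒ : ∀ {x y} → t ≈ 1# → x + - t * y ≈ 0# → x ≈ y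
      w-tv≈0⇒ {x} {y} t≈1 eq = begin-equality
        x                       ≈⟨ solve 3 (λ x t y → x := (x :+ (:- t) :* y) :+ t :* y) refl x t y ⟩
        (x + - t * y) + t * y   ≈⟨ +-cong eq (*-congʳ t≈1) ⟩
        0# + 1# * y             ≈⟨ trans (+-identityˡ (1# * y)) (*-identityˡ y) ⟩
        y                       ∎

      conclude : Null d ⊎ (∃[ S ] ¬ (d S ≈ 0#)) → w ≋ v × r ≈ q
      conclude (inj₂ some) = contradiction (support-SemiBalanced D nonNeg some) (minimal (support d)
        ((λ {S} → support-⊆ {d} {𝒮} d≈0 S) , λ 𝒮⊆ → ∈-support⁻ {d} (𝒮⊆ S₀∈𝒮) vanishes))
      conclude (inj₁ d≡0) = (λ S → w-tv≈0⇒ t≈1 (d≡0 S)) , w-tv≈0⇒ t≈1 (null⇒constant≈0 d≡0 D)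
        where
        -- Both totals are 1, so the total of the null vector d equals 1 - t.
        t≈1 : t ≈ 1#
        t≈1 = begin-equality
          t                          ≈⟨ solve 1 (λ t → t := (con (+ 1)) :- (con (+ 1) :+ (:- t) :* con (+ 1))) refl t ⟩
          1# - (1# + - t * 1#)       ≈⟨ sym (+-congˡ (-‿cong (+-cong Σw≈1 (*-congˡ Σv≈1)))) ⟩
          1# - (Σ⊆ w + - t * Σ⊆ v)   ≈⟨ sym (+-congˡ (-‿cong (Σ⊆-linear w v (- t)))) ⟩
          1# - Σ⊆ d                  ≈⟨ +-congˡ (-‿cong (trans (Σ⊆-cong d≡0) (Σ⊆-zero n))) ⟩
          1# - 0#                    ≈⟨ solve 0 (con (+ 1) :- con (+ 0) := con (+ 1)) refl ⟩
          1#                         ∎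

    -- `Forθ` demands existence and uniqueness besides the inequality. Existence comes from scaling
    -- the weights that witness semi-balancedness to total 1.
    AllDominated⇒NonNegOnMinSemiBalanced : AllDominated → NonNegOnMinSemiBalanced
    AllDominated⇒NonNegOnMinSemiBalanced dominated 𝒮 minSB@(sb@(nonTrivial , _) , _)
      with semiBalanced-weights sb
    ... | w , r , U , W , 0≤w , some , w≈0 =
      (assign w₁ (u * r) , Θ-assign nonTrivial w₁≈0 balanced nonNeg affine , λ {θ} → unique {θ}) ,
      Dominated⇒assign-nonNeg w₁ (u * r) (dominated w₁ (u * r) balanced nonNeg)
      where
      open Normalisation (normalisation W 0≤w some)

      w₁ : SetVector {n}
      w₁ S = u * w S

      w₁≈0 : ∀ S → S ∉ˢ 𝒮 → w₁ S ≈ 0#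
      w₁≈0 S S∉𝒮 = trans (*-congˡ (w≈0 S S∉𝒮)) (zeroʳ u)

      unique : ∀ {θ} → Θ 𝒮 θ → assign w₁ (u * r) ≋ θ
      unique {θ} (v , q , Σv≈1 , conic , yields , assigned) S =
        trans (assign-cong (proj₁ same) (proj₂ same) S) (sym (Assigned⇒≋ nonTrivial assigned S))
        where
        same : w₁ ≋ restrict 𝒮 v × u * r ≈ q
        -- `Affine 𝒮 v` unfolds to the statement that `restrict 𝒮 v` has total 1, so `Σv≈1` is
        -- passed as it is.
        same = MinSemiBalanced⇒unique minSB w₁≈0 (λ S S∉𝒮 → reflexive (restrict-∉ 𝒮 v S∉𝒮)) balanced nonNeg
          (restrict-Balanced {𝒮} nonTrivial yields) (proj₂ (restrict-NonNegOff {𝒮} conic)) affine Σv≈1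

    -- Induction on the support of w.  If it is not min-semi-balanced, pivoting
    -- on a smaller semi-balanced system writes w as a conic combination of two
    -- combinations of smaller support.
    NonNegOnMinSemiBalanced⇒AllDominated : NonNegOnMinSemiBalanced → AllDominated
    NonNegOnMinSemiBalanced⇒AllDominated hyp w r = induct w (<-wellFounded (card (support w))) r
      where
      -- The exceptional set is quantified inside the induction because the smaller combination v
      -- comes with its own.
      induct : ∀ w → Acc ℕ._<_ (card (support w)) → ∀ r {U} → Balanced w r → NonNegOff U w → Dominated w r
      induct w (acc smaller) r {U} W 0≤w with null? w
      ... | inj₁ w≈0  = null⇒Dominated w≈0 W
      -- Minimality of the support is not decided. The inequality is decidable, so it may be assumed
      -- to fail; then no smaller semi-balanced system can exist, and the support is minimal after
      -- all.
      ... | inj₂ some = decidable-stable (⟨ w , m ⟩ ≤? r * m ⊤) (λ ¬dom → ¬dom (if-minimal (sb , not-smaller ¬dom)))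
        where
        open Normalisation (normalisation W 0≤w some)

        sb : SemiBalanced (support w)
        sb = support-SemiBalanced W 0≤w some

        if-minimal : MinSemiBalanced (support w) → Dominated w r
        if-minimal minSB with hyp (support w) minSB
        ... | (θ , _ , unique) , 0≤θm = unscale-Dominated w r 0≤total total*u
          (assign-nonNeg⇒Dominated (λ S → u * w S) (u * r)
          (≤-trans 0≤θm (≤-reflexive (⟨⟩-congˡ m
            (unique (Θ-assign {support w} (proj₁ sb) (scaled-support w u) balanced nonNeg affine))))))

        -- In w = d + t v both parts have smaller support: v vanishes at `S₁`, which lies outside
        -- `𝒞`, and d vanishes at the pivot set `S₀`.
        not-smaller : ¬ Dominated w r → ∀ 𝒞 → 𝒞 ⊂ˢ support w → ¬ SemiBalanced 𝒞
        not-smaller ¬dom 𝒞 (𝒞⊆ , ⊈𝒞) 𝒞-sb with semiBalanced-weights 𝒞-sb | ⊈⇒∃ {𝒮 = support w} {𝒞} ⊈𝒞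
        ... | v , q , U′ , V , 0≤v , v-some , v≈0 | S₁ , S₁∈ , S₁∉𝒞 =
          ¬dom (Dominated-combine w v r q P.0≤t
            (induct v (smaller (card-strict v⊆w S₁ S₁∈ (λ S₁∈v → ∈-support⁻ {v} S₁∈v (v≈0 S₁ S₁∉𝒞)))) q V 0≤v)
            (induct d (smaller (card-strict d⊆w P.S₀ S₀∈ (λ S₀∈d → ∈-support⁻ {d} S₀∈d P.vanishes))) (r + - P.t * q)
              (Balanced-linear (- P.t) W V) P.nonNeg))
          where
          module P = Pivot (pivot {v = v} 0≤w (positive-off V 0≤v v-some U))

          d : SetVector {n}
          d S = w S + - P.t * v S

          v-off : ∀ S → S ∉ˢ support w → v S ≈ 0#
          v-off S S∉ = v≈0 S (S∉ ∘ 𝒞⊆)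

          v⊆w : ∀ S → S ∈ˢ support v → S ∈ˢ support w
          v⊆w = support-⊆ {v} {support w} v-off

          d⊆w : ∀ S → S ∈ˢ support d → S ∈ˢ support w
          d⊆w = support-⊆ {d} {support w} (λ S S∉ →
            trans (+-cong (∉-support⁻ {w} S∉) (trans (*-congˡ (v-off S S∉)) (zeroʳ (- P.t)))) (+-identityʳ 0#))

          S₀∈ : P.S₀ ∈ˢ support w
          S₀∈ = v⊆w P.S₀ (∈-support⁺ {v} P.v≉0)

    -- Exactness as consistency of linear inequalities.

    payoff-χ : ∀ (S : Subset n) (x : Vector {n}) → payoff x S ≈ χ S · x
    payoff-χ S x = sum-cong-≋ (λ i → pointwise (lookup S i) (x i))
      where
      pointwise : ∀ b y → (if b then y else 0#) ≈ (if b then 1# else 0#) * y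
      pointwise true  y = sym (*-identityˡ y)
      pointwise false y = sym (zeroˡ y)

    χ-⊤ : ∀ i → χ {n} ⊤ i ≈ 1#
    χ-⊤ i = reflexive (χ-inside ⊤ i (Vecₚ.lookup-replicate i inside))

    χ-⊥ : ∀ i → χ {n} ⊥ i ≈ 0#
    χ-⊥ i = reflexive (χ-outside ⊥ i (Vecₚ.lookup-replicate i outside))

    χ⊤· : ∀ (x : Vector {n}) → χ ⊤ · x ≈ sum x
    χ⊤· x = sum-cong-≋ (λ i → trans (*-congʳ (χ-⊤ i)) (*-identityˡ (x i)))

    -- Double counting: after exchanging the sums, each `x i` is weighted by the value of the
    -- combination at i, which is r.
    Balanced-⟨⟩ : ∀ {w r} → Balanced w r → ∀ (x : Vector {n}) → ⟨ w , (λ S → payoff x S) ⟩ ≈ r * sum x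
    Balanced-⟨⟩ {w} {r} W x = begin-equality
      ⟨ w , (λ S → payoff x S) ⟩
        ≈⟨ Σ⊆-cong (λ S → trans (*-congˡ (payoff-χ S x)) (*-distribˡ-sum (w S) (λ i → χ S i * x i))) ⟩
      Σ⊆ (λ S → sum (λ i → w S * (χ S i * x i)))
        ≈⟨ Σ⊆-sum-comm (λ S i → w S * (χ S i * x i)) ⟩
      sum (λ i → Σ⊆ (λ S → w S * (χ S i * x i)))
        ≈⟨ sum-cong-≋ (λ i → trans (Σ⊆-cong (λ S → solve 3 (λ w c x → w :* (c :* x) := x :* (w :* c)) refl (w S) (χ S i) (x i)))
             (Σ⊆-scale (λ S → w S * χ S i) (x i))) ⟩
      sum (λ i → x i * ⟨ w , (λ S → χ S i) ⟩)
        ≈⟨ sum-cong-≋ (λ i → trans (*-congˡ (Balanced.constant W i)) (*-comm (x i) r)) ⟩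
      sum (λ i → r * x i)
        ≈⟨ sym (*-distribˡ-sum r x) ⟩
      r * sum x ∎

    -- Weak duality, tested on a core element tight at the exceptional set: there the two sides
    -- agree, so the sign of the coefficient is harmless.
    Exact⇒AllDominated : Exact m → AllDominated
    Exact⇒AllDominated (_ , exact) w r {U} W 0≤w with exact U
    ... | x , (total≈ , m≤x) , tight = begin
      ⟨ w , m ⟩                     ≤⟨ Σ⊆-mono termwise ⟩
      ⟨ w , (λ S → payoff x S) ⟩       ≈⟨ Balanced-⟨⟩ W x ⟩
      r * sum x                     ≈⟨ *-congˡ total≈ ⟩
      r * m ⊤                       ∎
      where
      termwise : ∀ S → w S * m S ≤ w S * payoff x S
      termwise S with S ≟ˢ U
      ... | yes ≡.refl = ≤-reflexive (*-congˡ (sym tight))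
      ... | no  S≢U    = *-monoˡ-≤ (0≤w S S≢U) (m≤x S)

    private
      -- The factor is 1 for a lower bound on the payoff of `S` and -1 for an upper bound.
      generator : Carrier → Subset n → Constraint n
      generator t S = (λ i → t * χ S i) , t * m S

      -- The linear inequalities that follow from those defining the members
      -- of the core which are tight at U.
      Derivable : Subset n → Pred (Constraint n) (c ⊔ ℓ₁ ⊔ ℓ₂)
      Derivable U (a , b) = ∃[ w ] (∀ S → S ≢ U → S ≢ ⊤ → 0# ≤ w S) ×
                                   (∀ i → ⟨ w , (λ S → χ S i) ⟩ ≈ a i) × ⟨ w , m ⟩ ≈ b

      Derivable-isCone : ∀ U → IsCone (Derivable U)
      Derivable-isCone U = record
        { resp  = λ a≈a′ b≈b′ (w , 0≤w , wχ , wm) → w , 0≤w , (λ i → trans (wχ i) (a≈a′ i)) , trans wm b≈b′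
        ; add   = λ (w , 0≤w , wχ , wm) (v , 0≤v , vχ , vm) →
            (λ S → w S + 1# * v S) ,
            (λ S S≢U S≢⊤ → +-nonNeg (0≤w S S≢U S≢⊤) (*-nonNeg 0≤1 (0≤v S S≢U S≢⊤))) ,
            (λ i → trans (⟨⟩-linear w v 1# (λ S → χ S i)) (+-cong (wχ i) (trans (*-identityˡ ⟨ v , (λ S → χ S i) ⟩) (vχ i)))) ,
            trans (⟨⟩-linear w v 1# m) (+-cong wm (trans (*-identityˡ ⟨ v , m ⟩) vm))
        ; scale = λ {t} 0≤t (w , 0≤w , wχ , wm) →
            (λ S → t * w S) , (λ S S≢U S≢⊤ → *-nonNeg 0≤t (0≤w S S≢U S≢⊤)) ,
            (λ i → trans (⟨⟩-scale w t (λ S → χ S i)) (*-congˡ (wχ i))) , trans (⟨⟩-scale w t m) (*-congˡ wm)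
        }

      generator-Derivable : ∀ {U} t T → (∀ S → S ≢ U → S ≢ ⊤ → 0# ≤ t * δ T S) → Derivable U (generator t T)
      generator-Derivable t T 0≤tδ = (λ S → t * δ T S) , 0≤tδ ,
        (λ i → trans (⟨⟩-scale (δ T) t (λ S → χ S i)) (*-congˡ (Σ⊆-δ T (λ S → χ S i)))) ,
        trans (⟨⟩-scale (δ T) t m) (*-congˡ (Σ⊆-δ T m))

      -- Deleting the entries of w at N and ∅ turns a combination yielding 0 into a balanced v with
      -- constant `- w ⊤`. Its domination reads `b - w ⊤ * m ⊤ ≤ - w ⊤ * m ⊤`, where the terms at N
      -- cancel.
      AllDominated⇒consistent : AllDominated → ∀ U {b} → Derivable U ((λ _ → 0#) , b) → b ≤ 0#
      AllDominated⇒consistent dominated U {b} (w , 0≤w , wχ , wm) =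
        ≤-shift (solve 3 (λ W M b → (:- W) :* M :- ((b :+ (:- W) :* M) :+ con (+ 0)) := con (+ 0) :- b) refl (w ⊤) (m ⊤) b)
          (≤-trans (≤-reflexive (sym value)) (dominated v (- w ⊤) {U} V 0≤v))
        where
        v : SetVector {n}
        v S = (w S + - w ⊤ * δ ⊤ S) + - w ⊥ * δ ⊥ S

        v-⟨⟩ : ∀ f → ⟨ v , f ⟩ ≈ (⟨ w , f ⟩ + - w ⊤ * f ⊤) + - w ⊥ * f ⊥
        v-⟨⟩ f = trans (⟨⟩-linear (λ S → w S + - w ⊤ * δ ⊤ S) (δ ⊥) (- w ⊥) f)
          (+-cong (trans (⟨⟩-linear w (δ ⊤) (- w ⊤) f) (+-congˡ (*-congˡ (Σ⊆-δ ⊤ f)))) (*-congˡ (Σ⊆-δ ⊥ f)))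

        value : ⟨ v , m ⟩ ≈ (b + - w ⊤ * m ⊤) + 0#
        value = trans (v-⟨⟩ m) (+-cong (+-congʳ wm) (trans (*-congˡ m⊥≈0) (zeroʳ (- w ⊥))))

        v-⊥ : v ⊥ ≈ 0#
        v-⊥ = begin-equality
          (w ⊥ + - w ⊤ * 0#) + - w ⊥ * δ {n} ⊥ ⊥   ≈⟨ +-congˡ (*-congˡ (reflexive (δ-refl {n} ⊥))) ⟩
          (w ⊥ + - w ⊤ * 0#) + - w ⊥ * 1#
            ≈⟨ solve 2 (λ x y → (x :+ (:- y) :* con (+ 0)) :+ (:- x) :* con (+ 1) := con (+ 0)) refl (w ⊥) (w ⊤) ⟩
          0#                                       ∎

        v-⊤ : v ⊤ ≈ 0#
        v-⊤ = begin-equality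
          (w ⊤ + - w ⊤ * δ {n} ⊤ ⊤) + - w ⊥ * 0#   ≈⟨ +-congʳ (+-congˡ (*-congˡ (reflexive (δ-refl {n} ⊤)))) ⟩
          (w ⊤ + - w ⊤ * 1#) + - w ⊥ * 0#
            ≈⟨ solve 2 (λ x y → (x :+ (:- x) :* con (+ 1)) :+ (:- y) :* con (+ 0) := con (+ 0)) refl (w ⊤) (w ⊥) ⟩
          0#                                       ∎

        V : Balanced v (- w ⊤)
        V = record
          { at-∅     = v-⊥
          ; at-N     = v-⊤
          ; constant = λ i → begin-equality
              ⟨ v , (λ S → χ S i) ⟩
                ≈⟨ v-⟨⟩ (λ S → χ S i) ⟩
              (⟨ w , (λ S → χ S i) ⟩ + - w ⊤ * χ ⊤ i) + - w ⊥ * χ ⊥ i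
                ≈⟨ +-cong (+-cong (wχ i) (*-congˡ (χ-⊤ i))) (*-congˡ (χ-⊥ i)) ⟩
              (0# + - w ⊤ * 1#) + - w ⊥ * 0#
                ≈⟨ solve 2 (λ x y → (con (+ 0) :+ x :* con (+ 1)) :+ y :* con (+ 0) := x) refl (- w ⊤) (- w ⊥) ⟩
              - w ⊤ ∎
          }

        0≤v : NonNegOff U v
        0≤v S S≢U with S ≟ˢ ⊤ | S ≟ˢ ⊥
        ... | yes ≡.refl | _          = ≤-reflexive (sym v-⊤)
        ... | no _       | yes ≡.refl = ≤-reflexive (sym v-⊥)
        ... | no S≢⊤     | no S≢⊥     = ≤-trans (0≤w S S≢U S≢⊤) (≤-reflexive (begin-equality
          w S
            ≈⟨ solve 3 (λ x y z → x := (x :+ y :* con (+ 0)) :+ z :* con (+ 0)) refl (w S) (- w ⊤) (- w ⊥) ⟩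
          (w S + - w ⊤ * 0#) + - w ⊥ * 0#
            ≈⟨ sym (+-cong (+-congˡ (*-congˡ (reflexive (δ-≢ (S≢⊤ ∘ ≡.sym))))) (*-congˡ (reflexive (δ-≢ (S≢⊥ ∘ ≡.sym))))) ⟩
          v S ∎))

      satisfied-≥ : ∀ x S → Satisfies x (generator 1# S) → m S ≤ payoff x S
      satisfied-≥ x S sat = begin
        m S                          ≈⟨ sym (*-identityˡ (m S)) ⟩
        1# * m S                     ≤⟨ sat ⟩
        (λ i → 1# * χ S i) · x       ≈⟨ ·-* 1# (χ S) x ⟩
        1# * (χ S · x)               ≈⟨ *-identityˡ (χ S · x) ⟩
        χ S · x                      ≈⟨ sym (payoff-χ S x) ⟩
        payoff x S                      ∎

      satisfied-≤ : ∀ x S → Satisfies x (generator (- 1#) S) → payoff x S ≤ m S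
      satisfied-≤ x S sat = ≤-shift (trans
        (+-congʳ (trans (·-* (- 1#) (χ S) x) (*-congˡ (sym (payoff-χ S x)))))
        (solve 2 (λ x m → (:- con (+ 1)) :* x :- (:- con (+ 1)) :* m := m :- x) refl (payoff x S) (m S))) sat

    AllDominated⇒Exact : AllDominated → Exact m
    AllDominated⇒Exact dominated = m⊥≈0 , λ U → tight-point U (farkas n (Derivable-isCone U) (constraints U) (derivable U))
      where
      -- The two reversed constraints turn the lower bounds at `U` and at N into equalities:
      -- tightness and efficiency.
      constraints : Subset n → List (Constraint n)
      constraints U = generator (- 1#) U ∷ generator (- 1#) ⊤ ∷ map (generator 1#) (subsets n)

      nonNeg-δ : ∀ {T S} → S ≢ T → 0# ≤ - 1# * δ T S
      nonNeg-δ S≢T = ≤-reflexive (sym (trans (*-congˡ (reflexive (δ-≢ (S≢T ∘ ≡.sym)))) (zeroʳ (- 1#))))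

      derivable : ∀ U → All (Derivable U) (constraints U)
      derivable U = generator-Derivable (- 1#) U (λ S S≢U _ → nonNeg-δ S≢U)
        ∷ generator-Derivable (- 1#) ⊤ (λ S _ S≢⊤ → nonNeg-δ S≢⊤)
        ∷ Allₚ.map⁺ (All.universal (λ S →
            generator-Derivable 1# S (λ S′ _ _ → *-nonNeg 0≤1 (δ-nonNeg S S′))) (subsets n))

      tight-point : ∀ U → (∃[ x ] All (Satisfies x) (constraints U)) ⊎
                          (∃[ b ] ¬ (b ≤ 0#) × Derivable U ((λ _ → 0#) , b)) →
                    ∃[ x ] (Core m x × payoff x U ≈ m U)
      tight-point U (inj₂ (b , b≰0 , refutation)) =
        contradiction (AllDominated⇒consistent dominated U refutation) b≰0
      tight-point U (inj₁ (x , satU ∷ sat⊤ ∷ sat)) =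
        x , (trans (sym (trans (payoff-χ ⊤ x) (χ⊤· x))) (antisym (satisfied-≤ x ⊤ sat⊤) (m≤x ⊤)) , m≤x) ,
        antisym (satisfied-≤ x U satU) (m≤x U)
        where
        m≤x : ∀ S → m S ≤ payoff x S
        m≤x S = satisfied-≥ x S (All.lookup (Allₚ.map⁻ sat) (∈-subsets S))

corollary9 : ∀ {c ℓ₁ ℓ₂} (ℝ : Reals c ℓ₁ ℓ₂) → let open Games ℝ in
    ∀ (n : ℕ) → 2 ℕ.≤ n →
    ∀ (m : Subset n → Carrier) → IsGame m →
    (Exact m ⇔ (∀ (𝒮 : SetSystem n) → SemiBalanced 𝒮 → ∀ θ → Θ 𝒮 θ → 0# ≤ ⟨ θ , m ⟩))
    ×
    ((∀ (𝒮 : SetSystem n) → SemiBalanced 𝒮 → ∀ θ → Θ 𝒮 θ → 0# ≤ ⟨ θ , m ⟩)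
    ⇔ (∀ (𝒮 : SetSystem n) → MinSemiBalanced 𝒮 → Forθ 𝒮 (λ θ → 0# ≤ ⟨ θ , m ⟩)))
corollary9 ℝ (suc k) _ m game =
  mk⇔ (to-semi ∘ Exact⇒AllDominated m game) (AllDominated⇒Exact m game ∘ from-semi) ,
  mk⇔ (AllDominated⇒NonNegOnMinSemiBalanced m game ∘ from-semi)
      (to-semi ∘ NonNegOnMinSemiBalanced⇒AllDominated m game)
  where
  open Characterisation ℝ k
  to-semi   = AllDominated⇒NonNegOnSemiBalanced m game
  from-semi = NonNegOnSemiBalanced⇒AllDominated m game
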